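{- There exist $f\in\mathbb{N}^{\mathbb{N}}$ and $A\in 2^{\mathbb{N}}$ such that $f$ strongly relativizes $\Delta^0_1$ at $\mathbb{N}^{\mathbb{N}}$ and $f\equiv_T A$, but $A$ does not strongly relativize $\Delta^0_1$ at $\mathbb{N}^{\mathbb{N}}$, or even at $\mathbb{N}$. In particular, there exists $f\in\mathbb{N}^{\mathbb{N}}$ which strongly relativizes $\Delta^0_1$ at $\mathbb{N}^{\mathbb{N}}$ but is not computably dominated.
   Context: Elements of $2^{\mathbb{N}}$ are also regarded as elements of $\mathbb{N}^{\mathbb{N}}$. Let $\mathcal{X}$ be $\mathbb{N}$ or $\mathbb{N}^{\mathbb{N}}$. A subset of $\mathbb{N}^{\mathbb{N}}\times\mathcal{X}$ is $\Sigma^0_1$ if it is the union of a c.e. family of basic open sets $[\sigma]\times N$, where $[\sigma]=\{h\in\mathbb{N}^{\mathbb{N}}:\sigma\sqsubset h\}$ for a finite sequence $\sigma$, and $N$ is $\{n\}$ with $n\in\mathbb{N}$ (if $\mathcal{X}=\mathbb{N}$) or $[\tau]$ with $\tau$ a finite sequence (if $\mathcal{X}=\mathbb{N}^{\mathbb{N}}$); it is $\Delta^0_1$ if both it and its complement are $\Sigma^0_1$. For $f\in\mathbb{N}^{\mathbb{N}}$, $Q_f=\{x\in\mathcal{X}:Q(f,x)\}$. A set $P\subseteq\mathcal{X}$ is $\Delta^0_1(f)$ if both $P$ and its complement are $f$-sections of $\Sigma^0_1$ subsets of $\mathbb{N}^{\mathbb{N}}\times\mathcal{X}$. $f$ strongly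 relativizes $\Delta^0_1$ at $\mathcal{X}$ if every $\Delta^0_1(f)$ set $P\subseteq\mathcal{X}$ equals $Q_f$ for some $\Delta^0_1$ set $Q\subseteq\mathbb{N}^{\mathbb{N}}\times\mathcal{X}$. A real $f\in\mathbb{N}^{\mathbb{N}}$ is computably dominated if for every $g\in\mathbb{N}^{\mathbb{N}}$ with $g\le_T f$ there is a computable $h\in\mathbb{N}^{\mathbb{N}}$ with $g(n)\le h(n)$ for all $n$. -}

module Defs where

open import Data.Empty using (⊥)
open import Data.Fin using (Fin; toℕ)
open import Data.List using (List; []; _∷_; lookup)
open import Data.Nat using (ℕ; zero; suc; _+_; _≤_; _<_)
open import Data.Product using (_×_; _,_; proj₁; proj₂; ∃; ∃₂)
open import Data.Unit using (⊤)
open import Function using (_∘_; _⇔_)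
open import Level using (0ℓ)
open import Relation.Binary.PropositionalEquality using (_≡_)
open import Relation.Unary using (Pred; _∈_; _≐_; ∁)

Real : Set
Real = ℕ → ℕ

Cantor : Set
Cantor = ℕ → Fin 2

⌊_⌋ : Cantor → Real
⌊ A ⌋ = toℕ ∘ A

triangle : ℕ → ℕ
triangle zero    = 0
triangle (suc n) = suc n + triangle n

-- Cantor's pairing bijection.
⟨_,_⟩ : ℕ → ℕ → ℕ
⟨ x , y ⟩ = triangle (x + y) + y

-- unpair, the inverse of ⟨_,_⟩, walks along the antidiagonals:
-- (0,0), (1,0), (0,1), (2,0), (1,1), (0,2), …
nextPair : ℕ × ℕ → ℕ × ℕ
nextPair (zero  , y) = suc y , 0
nextPair (suc x , y) = x , suc y

unpair : ℕ → ℕ × ℕ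
unpair zero    = 0 , 0
unpair (suc n) = nextPair (unpair n)

π₁ π₂ : ℕ → ℕ
π₁ = proj₁ ∘ unpair
π₂ = proj₂ ∘ unpair

encode : List ℕ → ℕ
encode []      = 0
encode (x ∷ σ) = suc ⟨ x , encode σ ⟩

-- Programs for the unary partial functions that are partial recursive in
-- a family of oracles indexed by I.  Functions of several arguments are
-- represented through the pairing bijection.
data Code (I : Set) : Set where
  const0 succ left right : Code I
  oracle                 : I → Code I
  pair comp prec         : Code I → Code I → Code I
  min                    : Code I → Code I

-- Rec F G x k y means r x k = y, for the partial function r with
-- r x 0 = F x and r x (k + 1) = G ⟨ x , ⟨ k , r x k ⟩ ⟩.
Rec : (F G : ℕ → ℕ → Set) → ℕ → ℕ → ℕ → Set
Rec F G x zero    y = F x y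
Rec F G x (suc k) y = ∃ λ r → Rec F G x k r × G ⟨ x , ⟨ k , r ⟩ ⟩ y

-- ⟦ c ⟧ O x y: the program c with oracles O halts on input x with output y.
⟦_⟧ : ∀ {I} → Code I → (I → Real) → ℕ → ℕ → Set
⟦ const0   ⟧ O x y = y ≡ 0
⟦ succ     ⟧ O x y = y ≡ suc x
⟦ left     ⟧ O x y = y ≡ π₁ x
⟦ right    ⟧ O x y = y ≡ π₂ x
⟦ oracle i ⟧ O x y = y ≡ O i x
⟦ pair c d ⟧ O x y = ∃₂ λ a b → ⟦ c ⟧ O x a × ⟦ d ⟧ O x b × y ≡ ⟨ a , b ⟩
⟦ comp c d ⟧ O x y = ∃ λ z → ⟦ d ⟧ O x z × ⟦ c ⟧ O z y
⟦ prec c d ⟧ O x y = Rec (⟦ c ⟧ O) (⟦ d ⟧ O) (π₁ x) (π₂ x) y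
⟦ min c    ⟧ O x y = ⟦ c ⟧ O ⟨ x , y ⟩ 0 ×
                     (∀ z → z < y → ∃ λ m → ⟦ c ⟧ O ⟨ x , z ⟩ (suc m))

noOracle : ⊥ → Real
noOracle ()

Computable : Real → Set
Computable h = ∃ λ (c : Code ⊥) → ∀ n → ⟦ c ⟧ noOracle n (h n)

infix 4 _≤ᵀ_ _≡ᵀ_

_≤ᵀ_ : Real → Real → Set
g ≤ᵀ f = ∃ λ (c : Code ⊤) → ∀ n → ⟦ c ⟧ (λ _ → f) n (g n)

_≡ᵀ_ : Real → Real → Set
f ≡ᵀ g = f ≤ᵀ g × g ≤ᵀ f

CE : Pred ℕ 0ℓ → Set
CE W = ∃ λ (c : Code ⊥) → ∀ n → n ∈ W ⇔ (∃ λ y → ⟦ c ⟧ noOracle n y)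

ComputablyDominated : Real → Set
ComputablyDominated f =
  ∀ g → g ≤ᵀ f → ∃ λ h → Computable h × (∀ n → g n ≤ h n)

infix 4 _⊏_

_⊏_ : List ℕ → Real → Set
σ ⊏ h = ∀ i → lookup σ i ≡ h (toℕ i)

data Space : Set where
  nat baire : Space

Point : Space → Set
Point nat   = ℕ
Point baire = Real

-- Names of basic open sets: n names { n }, and τ names [ τ ].
Basic : Space → Set
Basic nat   = ℕ
Basic baire = List ℕ

Nbhd : ∀ 𝒳 → Basic 𝒳 → Pred (Point 𝒳) 0ℓ
Nbhd nat   n x = x ≡ n
Nbhd baire τ x = τ ⊏ x

code : ∀ 𝒳 → Basic 𝒳 → ℕ
code nat   n = n
code baire τ = encode τ

-- W consists of the codes ⟨ encode σ , code 𝒳 b ⟩ of the sets [σ] × Nbhd 𝒳 b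
-- in the family; numbers that are not such codes are ignored.
⋃Basic : ∀ 𝒳 → Pred ℕ 0ℓ → Pred (Real × Point 𝒳) 0ℓ
⋃Basic 𝒳 W (h , x) =
  ∃₂ λ σ b → ⟨ encode σ , code 𝒳 b ⟩ ∈ W × σ ⊏ h × x ∈ Nbhd 𝒳 b

Σ⁰₁ : ∀ 𝒳 → Pred (Real × Point 𝒳) 0ℓ → Set₁
Σ⁰₁ 𝒳 S = ∃ λ W → CE W × S ≐ ⋃Basic 𝒳 W

Δ⁰₁ : ∀ 𝒳 → Pred (Real × Point 𝒳) 0ℓ → Set₁
Δ⁰₁ 𝒳 S = Σ⁰₁ 𝒳 S × Σ⁰₁ 𝒳 (∁ S)

section : ∀ 𝒳 → Pred (Real × Point 𝒳) 0ℓ → Real → Pred (Point 𝒳) 0ℓ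
section 𝒳 Q f x = Q (f , x)

Σ⁰₁In : ∀ 𝒳 → Real → Pred (Point 𝒳) 0ℓ → Set₁
Σ⁰₁In 𝒳 f P = ∃ λ S → Σ⁰₁ 𝒳 S × P ≐ section 𝒳 S f

Δ⁰₁In : ∀ 𝒳 → Real → Pred (Point 𝒳) 0ℓ → Set₁
Δ⁰₁In 𝒳 f P = Σ⁰₁In 𝒳 f P × Σ⁰₁In 𝒳 f (∁ P)

StronglyRelativizesΔ⁰₁At : Space → Real → Set₁
StronglyRelativizesΔ⁰₁At 𝒳 f =
  ∀ (P : Pred (Point 𝒳) 0ℓ) → Δ⁰₁In 𝒳 f P →
  ∃ λ Q → Δ⁰₁ 𝒳 Q × P ≐ section 𝒳 Q f

{-# OPTIONS --safe #-}
module Submission where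

-- Let f be the universal partial computable function, coded as a total
-- function that is 0 on divergent inputs.  It is the only solution of a
-- system of local conditions, so {f} is a Π⁰₁ class; a Δ⁰₁(f) set extends to
-- a Δ⁰₁ set by also searching for a proof that the given oracle is not f.
-- Every computable function occurs inside f, so f is not computably dominated.
-- Let A be the graph of f.  By compactness of Cantor space, a Δ⁰₁ set that is
-- to define a subset of ℕ from A amounts to a truth-table reduction, whose use
-- and evaluation have indices i and j in f; consulting f about m = ⟨ i , j ⟩,
-- one diagonalizes against it at m, computably in A.

open import Defs
open import Axiom.ExcludedMiddle using (ExcludedMiddle)
open import Data.Bool using (Bool; true; false)
open import Data.Empty using (⊥; ⊥-elim)
open import Data.Fin using (Fin; zero; suc; toℕ)
open import Data.Fin.Properties using (toℕ<n)
open import Data.List using (List; []; _∷_; lookup; length; applyUpTo)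
open import Data.List.Properties using (lookup-applyUpTo)
open import Data.Nat
  using (ℕ; zero; suc; pred; _+_; _*_; _∸_; _⊔_; _≤_; _<_; z≤n; s≤s; s≤s⁻¹)
open import Data.Nat.Properties
open import Data.Product using (_×_; _,_; proj₁; proj₂; ∃; ∃₂; map₂)
open import Data.Sum using (_⊎_; inj₁; inj₂; [_,_]′)
open import Data.Unit using (⊤; tt)
open import Function using (_∘_; id; mk⇔; Equivalence)
open import Level using (0ℓ)
open import Relation.Binary.PropositionalEquality
open import Relation.Binary.Definitions using (tri<; tri≈; tri>)
open import Relation.Nullary using (¬_; yes; no)
open import Relation.Unary using (Pred; _≐_; ∁)

-- What separates `f` from its graph is the space they live in. A Π⁰₁ class of Cantor space with a
-- single member has a computable member, so the graph cannot be singled out in this way; in Baire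
-- space the unbounded values of `f` can carry their own evidence. The obstacle is unbounded search,
-- whose outcome is not a local fact. It becomes one because the value `suc y` names a stage from
-- which on the search must yield `y`, while the value 0 asserts that no stage succeeds: a wrong
-- claim of either kind is refuted at a finite stage. Passing to the graph keeps the Turing degree
-- but hides how far to look: `f x` is found from `A` by a search that need not end on other
-- oracles. The diagonal set is decided from `A` through such searches, which a reduction total on
-- every oracle cannot imitate.

private
  variable
    I K : Set
    n   : ℕ

-- The pairing bijection

unpair-⟨,⟩ : ∀ x y → unpair ⟨ x , y ⟩ ≡ (x , y)
unpair-⟨,⟩ x y = along (x + y) y x refl
  where
  along : ∀ n y x → x + y ≡ n → unpair (triangle n + y) ≡ (x , y)
  along zero    zero    zero    refl = refl
  along (suc n) zero    x       eq
    with refl ← trans (sym (+-identityʳ x)) eq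
    rewrite +-identityʳ (n + triangle n) | +-comm n (triangle n) | along n n 0 refl = refl
  along n       (suc y) x       eq
    rewrite +-suc (triangle n) y
          | along n y (suc x) (trans (sym (+-suc x y)) eq) = refl

π₁-⟨,⟩ : ∀ x y → π₁ ⟨ x , y ⟩ ≡ x
π₁-⟨,⟩ x y = cong proj₁ (unpair-⟨,⟩ x y)

π₂-⟨,⟩ : ∀ x y → π₂ ⟨ x , y ⟩ ≡ y
π₂-⟨,⟩ x y = cong proj₂ (unpair-⟨,⟩ x y)

⟨π₁,π₂⟩ : ∀ n → ⟨ π₁ n , π₂ n ⟩ ≡ n
⟨π₁,π₂⟩ zero    = refl
⟨π₁,π₂⟩ (suc n) = trans (next (unpair n)) (cong suc (⟨π₁,π₂⟩ n))
  where
  next : ∀ p → ⟨ proj₁ (nextPair p) , proj₂ (nextPair p) ⟩ ≡ suc ⟨ proj₁ p , proj₂ p ⟩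
  next (zero , y)  rewrite +-identityʳ y | +-identityʳ (y + triangle y) =
    cong suc (+-comm y (triangle y))
  next (suc x , y) rewrite +-suc x y = +-suc _ y

triangle-mono : ∀ {m n} → m ≤ n → triangle m ≤ triangle n
triangle-mono z≤n       = z≤n
triangle-mono (s≤s m≤n) = +-mono-≤ (s≤s m≤n) (triangle-mono m≤n)

⟨,⟩-mono : ∀ {x x′ y y′} → x ≤ x′ → y ≤ y′ → ⟨ x , y ⟩ ≤ ⟨ x′ , y′ ⟩
⟨,⟩-mono x≤ y≤ = +-mono-≤ (triangle-mono (+-mono-≤ x≤ y≤)) y≤

π₂≤ : ∀ n → π₂ n ≤ n
π₂≤ n = subst (π₂ n ≤_) (⟨π₁,π₂⟩ n) (m≤n+m _ _)

-- Total functions computable uniformly in the oracles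

Env : ℕ → Set
Env zero    = ⊤
Env (suc n) = Env n × ℕ

-- Pairs nest to the left, so that the last variable and weakening are single projections.
enc : Env n → ℕ
enc {zero}  _       = 0
enc {suc n} (ρ , x) = ⟨ enc ρ , x ⟩

Fun : Set → ℕ → Set
Fun K n = (K → Real) → Env n → ℕ

-- A shallow embedding: the combinators below build a program along with its correctness proof,
-- following the shape of the function.
record Computes (F : Fun K n) : Set where
  constructor by
  field
    program : Code K
    correct : ∀ O ρ → ⟦ program ⟧ O (enc ρ) (F O ρ)
open Computes

ext : {F G : Fun K n} → Computes F → (∀ O ρ → F O ρ ≡ G O ρ) → Computes G
ext (by c p) eq = by c λ O ρ → subst (⟦ c ⟧ O (enc ρ)) (eq O ρ) (p O ρ)

idCode : Code K
idCode = pair left right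

idCode-correct : ∀ (O : K → Real) x → ⟦ idCode ⟧ O x x
idCode-correct O x = _ , _ , refl , refl , sym (⟨π₁,π₂⟩ x)

varᶜ : Computes {K} {suc n} (λ O ρ → proj₂ ρ)
varᶜ = by right λ O ρ → sym (π₂-⟨,⟩ (enc (proj₁ ρ)) (proj₂ ρ))

envᶜ : Computes {K} {n} (λ O ρ → enc ρ)
envᶜ = by idCode λ O ρ → idCode-correct O (enc ρ)

zeroᶜ : Computes {K} {n} (λ O ρ → 0)
zeroᶜ = by const0 λ O ρ → refl

sucᶜ : {F : Fun K n} → Computes F → Computes (λ O ρ → suc (F O ρ))
sucᶜ (by c p) = by (comp succ c) λ O ρ → _ , p O ρ , refl

π₁ᶜ : {F : Fun K n} → Computes F → Computes (λ O ρ → π₁ (F O ρ))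
π₁ᶜ (by c p) = by (comp left c) λ O ρ → _ , p O ρ , refl

π₂ᶜ : {F : Fun K n} → Computes F → Computes (λ O ρ → π₂ (F O ρ))
π₂ᶜ (by c p) = by (comp right c) λ O ρ → _ , p O ρ , refl

oracleᶜ : ∀ {F : Fun K n} i → Computes F → Computes (λ O ρ → O i (F O ρ))
oracleᶜ i (by c p) = by (comp (oracle i) c) λ O ρ → _ , p O ρ , refl

pairᶜ : {F G : Fun K n} → Computes F → Computes G → Computes (λ O ρ → ⟨ F O ρ , G O ρ ⟩)
pairᶜ (by c p) (by d q) = by (pair c d) λ O ρ → _ , _ , p O ρ , q O ρ , refl

substᶜ : ∀ {F : Fun K n} {m} (θ : (K → Real) → Env m → Env n) → Computes F →
         Computes (λ O ρ → enc (θ O ρ)) → Computes (λ O ρ → F O (θ O ρ))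
substᶜ θ (by c p) (by d q) = by (comp c d) λ O ρ → _ , q O ρ , p O (θ O ρ)

wkᶜ : {F : Fun K n} → Computes F → Computes {n = suc n} (λ O ρ → F O (proj₁ ρ))
wkᶜ (by c p) = by (comp c left) λ O ρ → _ , sym (π₁-⟨,⟩ _ (proj₂ ρ)) , p O (proj₁ ρ)

letᶜ : {G : Fun K n} {F : Fun K (suc n)} → Computes F → Computes G →
       Computes (λ O ρ → F O (ρ , G O ρ))
letᶜ cF cG = substᶜ (λ O ρ → ρ , _) cF (pairᶜ envᶜ cG)

natrec : ℕ → (ℕ → ℕ → ℕ) → ℕ → ℕ
natrec b s zero    = b
natrec b s (suc k) = s k (natrec b s k)

natrecᶜ : {F G : Fun K n} {S : Fun K (suc (suc n))} → Computes F → Computes S → Computes G →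
          Computes (λ O ρ → natrec (F O ρ) (λ k r → S O ((ρ , k) , r)) (G O ρ))
natrecᶜ {F = F} {G = G} {S} (by b p) (by s q) (by d r) =
  by (comp (prec b s′) (pair idCode d)) λ O ρ →
    _ , (_ , _ , idCode-correct O (enc ρ) , r O ρ , refl) ,
    subst₂ (λ x k → Rec (⟦ b ⟧ O) (⟦ s′ ⟧ O) x k (natrec (F O ρ) _ (G O ρ)))
      (sym (π₁-⟨,⟩ _ _)) (sym (π₂-⟨,⟩ (enc ρ) _)) (loop O ρ (G O ρ))
  where
  -- `prec` supplies `⟨ x , ⟨ k , r ⟩ ⟩`, whereas the environment of the step is coded
  -- `⟨ ⟨ x , k ⟩ , r ⟩`.
  s′ = comp s (pair (pair left (comp left right)) (comp right right))
  assoc : ∀ O x k r → ⟦ pair (pair left (comp left right)) (comp right right) ⟧ O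
                        ⟨ x , ⟨ k , r ⟩ ⟩ ⟨ ⟨ x , k ⟩ , r ⟩
  assoc O x k r =
    _ , _ , (_ , _ , sym (π₁-⟨,⟩ x _) , (_ , sym (π₂-⟨,⟩ x _) , sym (π₁-⟨,⟩ k r)) , refl)
          , (_ , sym (π₂-⟨,⟩ x _) , sym (π₂-⟨,⟩ k r)) , refl
  loop : ∀ O ρ k → Rec (⟦ b ⟧ O) (⟦ s′ ⟧ O) (enc ρ) k
                     (natrec (F O ρ) (λ k r → S O ((ρ , k) , r)) k)
  loop O ρ zero    = p O ρ
  loop O ρ (suc k) = _ , loop O ρ k , _ , assoc O (enc ρ) k _ , q O ((ρ , k) , _)

ifz : ℕ → ℕ → ℕ → ℕ
ifz zero    a b = a
ifz (suc _) a b = b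

ifzᶜ : {F G H : Fun K n} → Computes F → Computes G → Computes H →
       Computes (λ O ρ → ifz (F O ρ) (G O ρ) (H O ρ))
ifzᶜ {F = F} {G = G} {H = H} f g h =
  ext (natrecᶜ g (wkᶜ (wkᶜ h)) f) λ O ρ → lemma (F O ρ) (G O ρ) (H O ρ)
  where
  lemma : ∀ k a b → natrec a (λ _ _ → b) k ≡ ifz k a b
  lemma zero    a b = refl
  lemma (suc k) a b = refl

predᶜ : {F : Fun K n} → Computes F → Computes (λ O ρ → pred (F O ρ))
predᶜ {F = F} f = ext (natrecᶜ zeroᶜ (wkᶜ varᶜ) f) λ O ρ → lemma (F O ρ)
  where
  lemma : ∀ k → natrec 0 (λ j _ → j) k ≡ pred k
  lemma zero    = refl
  lemma (suc k) = refl

infixl 6 _+ᶜ_ _∸ᶜ_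
infixl 7 _*ᶜ_

_+ᶜ_ : {F G : Fun K n} → Computes F → Computes G → Computes (λ O ρ → F O ρ + G O ρ)
_+ᶜ_ {F = F} {G = G} f g = ext (natrecᶜ g (sucᶜ varᶜ) f) λ O ρ → lemma (F O ρ) (G O ρ)
  where
  lemma : ∀ a b → natrec b (λ _ r → suc r) a ≡ a + b
  lemma zero    b = refl
  lemma (suc a) b = cong suc (lemma a b)

_*ᶜ_ : {F G : Fun K n} → Computes F → Computes G → Computes (λ O ρ → F O ρ * G O ρ)
_*ᶜ_ {F = F} {G = G} f g =
  ext (natrecᶜ zeroᶜ (wkᶜ (wkᶜ g) +ᶜ varᶜ) f) λ O ρ → lemma (F O ρ) (G O ρ)
  where
  lemma : ∀ a b → natrec 0 (λ _ r → b + r) a ≡ a * b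
  lemma zero    b = refl
  lemma (suc a) b = cong (b +_) (lemma a b)

_∸ᶜ_ : {F G : Fun K n} → Computes F → Computes G → Computes (λ O ρ → F O ρ ∸ G O ρ)
_∸ᶜ_ {F = F} {G = G} f g = ext (natrecᶜ f (predᶜ varᶜ) g) λ O ρ → lemma (F O ρ) (G O ρ)
  where
  lemma : ∀ a b → natrec a (λ _ r → pred r) b ≡ a ∸ b
  lemma a zero    = refl
  lemma a (suc b) = trans (cong pred (lemma a b)) (pred[m∸n]≡m∸[1+n] a b)

-- In tests 0 stands for truth, so that _+_ is conjunction, _*_ is
-- disjunction, isZero is negation and a finite sum is bounded quantification.

isZero : ℕ → ℕ
isZero k = ifz k 1 0

isZero-true : ∀ {k} → isZero k ≡ 0 → k ≢ 0
isZero-true () refl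

isZero-false : ∀ {k} → k ≢ 0 → isZero k ≡ 0
isZero-false {zero}  k≢0 = ⊥-elim (k≢0 refl)
isZero-false {suc k} _   = refl

isZeroᶜ : {F : Fun K n} → Computes F → Computes (λ O ρ → isZero (F O ρ))
isZeroᶜ f = ifzᶜ f (sucᶜ zeroᶜ) zeroᶜ

dist : ℕ → ℕ → ℕ
dist a b = (a ∸ b) + (b ∸ a)

dist≡0⇒≡ : ∀ a b → dist a b ≡ 0 → a ≡ b
dist≡0⇒≡ a b eq =
  ≤-antisym (m∸n≡0⇒m≤n (m+n≡0⇒m≡0 (a ∸ b) eq)) (m∸n≡0⇒m≤n (m+n≡0⇒n≡0 (a ∸ b) eq))

≡⇒dist≡0 : ∀ {a b} → a ≡ b → dist a b ≡ 0
≡⇒dist≡0 {a} refl = cong₂ _+_ (n∸n≡0 a) (n∸n≡0 a)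

distᶜ : {F G : Fun K n} → Computes F → Computes G → Computes (λ O ρ → dist (F O ρ) (G O ρ))
distᶜ f g = (f ∸ᶜ g) +ᶜ (g ∸ᶜ f)

sum< : ℕ → (ℕ → ℕ) → ℕ
sum< k t = natrec 0 (λ j r → t j + r) k

sum<≡0 : ∀ k t → sum< k t ≡ 0 → ∀ j → j < k → t j ≡ 0
sum<≡0 (suc k) t eq j j<1+k with m≤n⇒m<n∨m≡n (s≤s⁻¹ j<1+k)
... | inj₁ j<k  = sum<≡0 k t (m+n≡0⇒n≡0 (t k) eq) j j<k
... | inj₂ refl = m+n≡0⇒m≡0 (t k) eq

sum<≡0⁻ : ∀ k t → (∀ j → j < k → t j ≡ 0) → sum< k t ≡ 0
sum<≡0⁻ zero    t all = refl
sum<≡0⁻ (suc k) t all = cong₂ _+_ (all k ≤-refl) (sum<≡0⁻ k t λ j j<k → all j (m<n⇒m<1+n j<k))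

sum<ᶜ : {F : Fun K n} {T : Fun K (suc n)} → Computes F → Computes T →
        Computes (λ O ρ → sum< (F O ρ) (λ j → T O (ρ , j)))
sum<ᶜ f t = natrecᶜ zeroᶜ (wkᶜ t +ᶜ varᶜ) f

-- A partial function is represented by the total function that takes the
-- value suc y where it is y, and 0 where it is undefined.

Graph : (ℕ → ℕ) → ℕ → ℕ → Set
Graph g x y = g x ≡ suc y

infix 4 _⊆₂_

_⊆₂_ : (R S : ℕ → ℕ → Set) → Set
R ⊆₂ S = ∀ x y → R x y → S x y

PairR CompR PrecR : (R S : ℕ → ℕ → Set) → ℕ → ℕ → Set
PairR R S x y = ∃₂ λ a b → R x a × S x b × y ≡ ⟨ a , b ⟩
CompR R S x y = ∃ λ z → S x z × R z y
PrecR R S x y = Rec R S (π₁ x) (π₂ x) y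

MinR : (R : ℕ → ℕ → Set) → ℕ → ℕ → Set
MinR R x y = R ⟨ x , y ⟩ 0 × (∀ z → z < y → ∃ λ m → R ⟨ x , z ⟩ (suc m))

PairR-mono : ∀ {R R′ S S′} → R ⊆₂ R′ → S ⊆₂ S′ → PairR R S ⊆₂ PairR R′ S′
PairR-mono r s x y (a , b , p , q , eq) = a , b , r _ _ p , s _ _ q , eq

CompR-mono : ∀ {R R′ S S′} → R ⊆₂ R′ → S ⊆₂ S′ → CompR R S ⊆₂ CompR R′ S′
CompR-mono r s x y (z , p , q) = z , s _ _ p , r _ _ q

PrecR-mono : ∀ {R R′ S S′} → R ⊆₂ R′ → S ⊆₂ S′ → PrecR R S ⊆₂ PrecR R′ S′
PrecR-mono {R} {R′} {S} {S′} r s x = loop (π₂ x)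
  where
  loop : ∀ k y → Rec R S (π₁ x) k y → Rec R′ S′ (π₁ x) k y
  loop zero    y p           = r _ _ p
  loop (suc k) y (v , p , q) = v , loop k v p , s _ _ q

MinR-mono : ∀ {R R′} → R ⊆₂ R′ → MinR R ⊆₂ MinR R′
MinR-mono r x y (p , ps) = r _ _ p , λ z z<y → map₂ (r _ _) (ps z z<y)

pairS compS precS : (g h : ℕ → ℕ) → ℕ → ℕ
pairS g h x = ifz (g x) 0 (ifz (h x) 0 (suc ⟨ pred (g x) , pred (h x) ⟩))
compS g h x = ifz (h x) 0 (g (pred (h x)))
precS g h x =
  natrec (g (π₁ x)) (λ k r → ifz r 0 (h ⟨ π₁ x , ⟨ k , pred r ⟩ ⟩)) (π₂ x)

-- The state is 0 while the search is going on, 1 once it has met an undefined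
-- value, and y + 2 once it has found y.
searchS : (g : ℕ → ℕ) → ℕ → ℕ → ℕ
searchS g x = natrec 0 λ k state →
  ifz state (ifz (g ⟨ x , k ⟩) 1 (ifz (pred (g ⟨ x , k ⟩)) (suc (suc k)) 0)) state

-- `pred` sends the unfinished state 0 and the blocked state 1 to undefined, and `y + 2` to the
-- defined value `y`.
minS : ℕ → (g : ℕ → ℕ) → ℕ → ℕ
minS s g x = pred (searchS g x s)

private
  variable
    g g′ h h′ : ℕ → ℕ

ifz-suc : ∀ k {b y} → ifz k 0 b ≡ suc y → k ≡ suc (pred k) × b ≡ suc y
ifz-suc (suc k) eq = refl , eq

pairS⇒ : ∀ g h → Graph (pairS g h) ⊆₂ PairR (Graph g) (Graph h)
pairS⇒ g h x y eq
  with p , eq′ ← ifz-suc (g x) eq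
  with q , eq″ ← ifz-suc (h x) eq′ = _ , _ , p , q , sym (suc-injective eq″)

pairS⇐ : ∀ g h → PairR (Graph g) (Graph h) ⊆₂ Graph (pairS g h)
pairS⇐ g h x y (a , b , p , q , refl) rewrite p | q = refl

compS⇒ : ∀ g h → Graph (compS g h) ⊆₂ CompR (Graph g) (Graph h)
compS⇒ g h x y eq with p , eq′ ← ifz-suc (h x) eq = _ , p , eq′

compS⇐ : ∀ g h → CompR (Graph g) (Graph h) ⊆₂ Graph (compS g h)
compS⇐ g h x y (z , p , q) rewrite p = q

precS⇒ : ∀ g h → Graph (precS g h) ⊆₂ PrecR (Graph g) (Graph h)
precS⇒ g h x = loop (π₂ x)
  where
  value : ℕ → ℕ
  value = natrec (g (π₁ x)) λ k r → ifz r 0 (h ⟨ π₁ x , ⟨ k , pred r ⟩ ⟩)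
  loop : ∀ k y → value k ≡ suc y → Rec (Graph g) (Graph h) (π₁ x) k y
  loop zero    y eq = eq
  loop (suc k) y eq with p , eq′ ← ifz-suc (value k) eq = _ , loop k _ p , eq′

precS⇐ : ∀ g h → PrecR (Graph g) (Graph h) ⊆₂ Graph (precS g h)
precS⇐ g h x = loop (π₂ x)
  where
  loop : ∀ k y → Rec (Graph g) (Graph h) (π₁ x) k y →
         natrec (g (π₁ x)) (λ k r → ifz r 0 (h ⟨ π₁ x , ⟨ k , pred r ⟩ ⟩)) k ≡ suc y
  loop zero    y p           = p
  loop (suc k) y (v , p , q) rewrite loop k v p = q

searching⇒ : ∀ g s x → searchS g x s ≡ 0 → ∀ z → z < s → ∃ λ m → Graph g ⟨ x , z ⟩ (suc m)
searching⇒ g (suc s) x eq z z<1+s with searchS g x s in st | g ⟨ x , s ⟩ in v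
... | zero | suc (suc m) with m≤n⇒m<n∨m≡n (s≤s⁻¹ z<1+s)
...   | inj₁ z<s  = searching⇒ g s x st z z<s
...   | inj₂ refl = m , v

searching⇐ : ∀ g s x → (∀ z → z < s → ∃ λ m → Graph g ⟨ x , z ⟩ (suc m)) → searchS g x s ≡ 0
searching⇐ g zero    x all = refl
searching⇐ g (suc s) x all
  rewrite searching⇐ g s x (λ z z<s → all z (m<n⇒m<1+n z<s)) | proj₂ (all s ≤-refl) = refl

found⇒ : ∀ g s x y → searchS g x s ≡ suc (suc y) → y < s × MinR (Graph g) x y
found⇒ g (suc s) x y eq with searchS g x s in st | g ⟨ x , s ⟩ in v
found⇒ g (suc s) x y refl | zero  | suc zero = ≤-refl , v , searching⇒ g s x st
found⇒ g (suc s) x y refl | suc _ | _ with y<s , p ← found⇒ g s x y st = m<n⇒m<1+n y<s , p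

found⇐ : ∀ g s x y → y < s → MinR (Graph g) x y → searchS g x s ≡ suc (suc y)
found⇐ g (suc s) x y y<1+s (p , ps) with m≤n⇒m<n∨m≡n (s≤s⁻¹ y<1+s)
... | inj₁ y<s  rewrite found⇐ g s x y y<s (p , ps) = refl
... | inj₂ refl rewrite searching⇐ g s x ps | p = refl

minS⇒ : ∀ g s x y → Graph (minS s g) x y → y < s × MinR (Graph g) x y
minS⇒ g s x y eq = found⇒ g s x y (lemma (searchS g x s) eq)
  where
  lemma : ∀ k → pred k ≡ suc y → k ≡ suc (suc y)
  lemma (suc k) refl = refl

-- The stage limits the candidates tried, not the evaluation of `g`; hence any stage beyond `y` is
-- enough, and a result bounds its own search.
minS⇐ : ∀ g s x y → y < s → MinR (Graph g) x y → Graph (minS s g) x y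
minS⇐ g s x y y<s p = cong pred (found⇐ g s x y y<s p)

pairS-mono : Graph g ⊆₂ Graph g′ → Graph h ⊆₂ Graph h′ →
             Graph (pairS g h) ⊆₂ Graph (pairS g′ h′)
pairS-mono {g} {g′} {h} {h′} p q x y = pairS⇐ g′ h′ x y ∘ PairR-mono p q x y ∘ pairS⇒ g h x y

compS-mono : Graph g ⊆₂ Graph g′ → Graph h ⊆₂ Graph h′ →
             Graph (compS g h) ⊆₂ Graph (compS g′ h′)
compS-mono {g} {g′} {h} {h′} p q x y = compS⇐ g′ h′ x y ∘ CompR-mono p q x y ∘ compS⇒ g h x y

precS-mono : Graph g ⊆₂ Graph g′ → Graph h ⊆₂ Graph h′ →
             Graph (precS g h) ⊆₂ Graph (precS g′ h′)
precS-mono {g} {g′} {h} {h′} p q x y = precS⇐ g′ h′ x y ∘ PrecR-mono p q x y ∘ precS⇒ g h x y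

minS-mono : ∀ {s s′} → s ≤ s′ → Graph g ⊆₂ Graph g′ → Graph (minS s g) ⊆₂ Graph (minS s′ g′)
minS-mono {g} {g′} {s} {s′} s≤s′ p x y eq with y<s , q ← minS⇒ g s x y eq =
  minS⇐ g′ s′ x y (<-≤-trans y<s s≤s′) (MinR-mono p x y q)

module _ {K : Set} {n : ℕ} {g : (K → Real) → Env n → ℕ → ℕ}
  (gᶜ : Computes {n = suc n} (λ O ρ → g O (proj₁ ρ) (proj₂ ρ)))
  where

  private
    applyᶜ : ∀ {m} {X : Fun K m} (θ : (K → Real) → Env m → Env n) →
             Computes (λ O ρ → enc (θ O ρ)) → Computes X →
             Computes (λ O ρ → g O (θ O ρ) (X O ρ))
    applyᶜ θ θᶜ x = substᶜ (λ O ρ → θ O ρ , _) gᶜ (pairᶜ θᶜ x)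

  minSᶜ : {S : Fun K n} → Computes S →
          Computes {n = suc n} (λ O ρ → minS (S O (proj₁ ρ)) (g O (proj₁ ρ)) (proj₂ ρ))
  minSᶜ s = predᶜ (natrecᶜ zeroᶜ
    (ifzᶜ varᶜ (ifzᶜ v (sucᶜ zeroᶜ) (ifzᶜ (predᶜ v) (sucᶜ (sucᶜ (wkᶜ varᶜ))) zeroᶜ)) varᶜ)
    (wkᶜ s))
    where
    v = applyᶜ (λ O ρ → proj₁ (proj₁ (proj₁ ρ))) (wkᶜ (wkᶜ (wkᶜ envᶜ)))
          (pairᶜ (wkᶜ (wkᶜ varᶜ)) (wkᶜ varᶜ))

  module _ {h : (K → Real) → Env n → ℕ → ℕ}
    (hᶜ : Computes {n = suc n} (λ O ρ → h O (proj₁ ρ) (proj₂ ρ)))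
    where

    pairSᶜ : Computes {n = suc n} (λ O ρ → pairS (g O (proj₁ ρ)) (h O (proj₁ ρ)) (proj₂ ρ))
    pairSᶜ = ifzᶜ gᶜ zeroᶜ (ifzᶜ hᶜ zeroᶜ (sucᶜ (pairᶜ (predᶜ gᶜ) (predᶜ hᶜ))))

    compSᶜ : Computes {n = suc n} (λ O ρ → compS (g O (proj₁ ρ)) (h O (proj₁ ρ)) (proj₂ ρ))
    compSᶜ = ifzᶜ hᶜ zeroᶜ (applyᶜ (λ O ρ → proj₁ ρ) (wkᶜ envᶜ) (predᶜ hᶜ))

    precSᶜ : Computes {n = suc n} (λ O ρ → precS (g O (proj₁ ρ)) (h O (proj₁ ρ)) (proj₂ ρ))
    precSᶜ =
      natrecᶜ (applyᶜ (λ O ρ → proj₁ ρ) (wkᶜ envᶜ) (π₁ᶜ varᶜ))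
        (ifzᶜ varᶜ zeroᶜ (substᶜ (λ O ρ → proj₁ (proj₁ (proj₁ ρ)) , _) hᶜ
          (pairᶜ (wkᶜ (wkᶜ (wkᶜ envᶜ)))
            (pairᶜ (π₁ᶜ (wkᶜ (wkᶜ varᶜ))) (pairᶜ (wkᶜ varᶜ) (predᶜ varᶜ))))))
        (π₂ᶜ varᶜ)

-- Staged evaluation: the searches of a program are cut off at the stage s.
step : Code I → (I → ℕ → ℕ) → ℕ → ℕ → ℕ
step const0     ψ s x = 1
step succ       ψ s x = suc (suc x)
step left       ψ s x = suc (π₁ x)
step right      ψ s x = suc (π₂ x)
step (oracle i) ψ s x = ψ i x
step (pair c d) ψ s   = pairS (step c ψ s) (step d ψ s)
step (comp c d) ψ s   = compS (step c ψ s) (step d ψ s)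
step (prec c d) ψ s   = precS (step c ψ s) (step d ψ s)
step (min c)    ψ s   = minS s (step c ψ s)

-- The partial oracle `ψ` answers 0 where nothing is known, so finite information about a real can
-- be fed to a fixed program `c` computably.
stepᶜ : (c : Code I) {ψ : I → (K → Real) → Env n → ℕ → ℕ} {S : Fun K n} →
        (∀ i → Computes {n = suc n} (λ O ρ → ψ i O (proj₁ ρ) (proj₂ ρ))) → Computes S →
        Computes {n = suc n}
          (λ O ρ → step c (λ i → ψ i O (proj₁ ρ)) (S O (proj₁ ρ)) (proj₂ ρ))
stepᶜ const0     ψ s = sucᶜ zeroᶜ
stepᶜ succ       ψ s = sucᶜ (sucᶜ varᶜ)
stepᶜ left       ψ s = sucᶜ (π₁ᶜ varᶜ)
stepᶜ right      ψ s = sucᶜ (π₂ᶜ varᶜ)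
stepᶜ (oracle i) ψ s = ψ i
stepᶜ (pair c d) ψ s = pairSᶜ (stepᶜ c ψ s) (stepᶜ d ψ s)
stepᶜ (comp c d) ψ s = compSᶜ (stepᶜ c ψ s) (stepᶜ d ψ s)
stepᶜ (prec c d) ψ s = precSᶜ (stepᶜ c ψ s) (stepᶜ d ψ s)
stepᶜ (min c)    ψ s = minSᶜ (stepᶜ c ψ s) s

module _ {ψ : I → ℕ → ℕ} {O : I → Real} (ψ⊆O : ∀ i → Graph (ψ i) ⊆₂ λ q v → v ≡ O i q) where

  step-sound : ∀ c s → Graph (step c ψ s) ⊆₂ ⟦ c ⟧ O
  step-sound const0     s x y refl = refl
  step-sound succ       s x y refl = refl
  step-sound left       s x y refl = refl
  step-sound right      s x y refl = refl
  step-sound (oracle i) s x y eq   = ψ⊆O i x y eq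
  step-sound (pair c d) s x y =
    PairR-mono (step-sound c s) (step-sound d s) x y ∘ pairS⇒ (step c ψ s) (step d ψ s) x y
  step-sound (comp c d) s x y =
    CompR-mono (step-sound c s) (step-sound d s) x y ∘ compS⇒ (step c ψ s) (step d ψ s) x y
  step-sound (prec c d) s x y =
    PrecR-mono (step-sound c s) (step-sound d s) x y ∘ precS⇒ (step c ψ s) (step d ψ s) x y
  step-sound (min c)    s x y = MinR-mono (step-sound c s) x y ∘ proj₂ ∘ minS⇒ (step c ψ s) s x y

module _ {ψ ψ′ : I → ℕ → ℕ} {s s′} (ψ⊆ψ′ : ∀ i → Graph (ψ i) ⊆₂ Graph (ψ′ i)) (s≤s′ : s ≤ s′)
  where

  step-mono : ∀ c → Graph (step c ψ s) ⊆₂ Graph (step c ψ′ s′)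
  step-mono const0     x y eq = eq
  step-mono succ       x y eq = eq
  step-mono left       x y eq = eq
  step-mono right      x y eq = eq
  step-mono (oracle i) = ψ⊆ψ′ i
  step-mono (pair c d) = pairS-mono (step-mono c) (step-mono d)
  step-mono (comp c d) = compS-mono (step-mono c) (step-mono d)
  step-mono (prec c d) = precS-mono (step-mono c) (step-mono d)
  step-mono (min c)    = minS-mono s≤s′ (step-mono c)

-- Use principle and determinism

Eventually : (ℕ → Set) → Set
Eventually P = ∃ λ s₀ → ∀ s → s₀ ≤ s → P s

private
  variable
    P Q : ℕ → Set

always : (∀ s → P s) → Eventually P
always p = 0 , λ s _ → p s

ev-map : (∀ s → P s → Q s) → Eventually P → Eventually Q
ev-map f (s₀ , p) = s₀ , λ s le → f s (p s le)

ev-× : Eventually P → Eventually Q → Eventually (λ s → P s × Q s)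
ev-× (s₀ , p) (s₁ , q) =
  s₀ ⊔ s₁ , λ s le → p s (m⊔n≤o⇒m≤o s₀ s₁ le) , q s (m⊔n≤o⇒n≤o s₀ s₁ le)

ev-∀< : {P : ℕ → ℕ → Set} → ∀ k → (∀ z → z < k → Eventually (P z)) →
        Eventually (λ s → ∀ z → z < k → P z s)
ev-∀< zero    _   = always λ s z ()
ev-∀< {P} (suc k) all =
  ev-map join (ev-× (ev-∀< {P} k (λ z z<k → all z (m<n⇒m<1+n z<k))) (all k ≤-refl))
  where
  join : ∀ s → (∀ z → z < k → P z s) × P k s → ∀ z → z < suc k → P z s
  join s (ps , p) z z<1+k with m≤n⇒m<n∨m≡n (s≤s⁻¹ z<1+k)
  ... | inj₁ z<k  = ps z z<k
  ... | inj₂ refl = p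

infix 8 _↾_

_↾_ : (I → Real) → ℕ → I → ℕ → ℕ
(O ↾ s) i q = ifz (suc q ∸ s) (suc (O i q)) 0

↾-defined : ∀ (O : I → Real) {s} i {q} → q < s → Graph ((O ↾ s) i) q (O i q)
↾-defined O i q<s rewrite m≤n⇒m∸n≡0 q<s = refl

↾-sound : ∀ (O : I → Real) s i q v → Graph ((O ↾ s) i) q v → q < s × v ≡ O i q
↾-sound O s i q v eq with suc q ∸ s in le
↾-sound O s i q v refl | zero = m∸n≡0⇒m≤n le , refl

-- A halting computation makes finitely many oracle queries and bounded searches, so one number can
-- truncate both.
step-complete : ∀ (O : I → Real) c x y → ⟦ c ⟧ O x y →
                Eventually (λ s → Graph (step c (O ↾ s) s) x y)
step-complete O const0     x y refl = always λ s → refl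
step-complete O succ       x y refl = always λ s → refl
step-complete O left       x y refl = always λ s → refl
step-complete O right      x y refl = always λ s → refl
step-complete O (oracle i) x y refl = suc x , λ s x<s → ↾-defined O i x<s
step-complete O (pair c d) x y (a , b , p , q , eq) =
  ev-map (λ s (p , q) → pairS⇐ (step c (O ↾ s) s) (step d (O ↾ s) s) x y (a , b , p , q , eq))
    (ev-× (step-complete O c x a p) (step-complete O d x b q))
step-complete O (comp c d) x y (z , p , q) =
  ev-map (λ s (p , q) → compS⇐ (step c (O ↾ s) s) (step d (O ↾ s) s) x y (z , p , q))
    (ev-× (step-complete O d x z p) (step-complete O c z y q))
step-complete O (prec c d) x y p =
  ev-map (λ s → precS⇐ (step c (O ↾ s) s) (step d (O ↾ s) s) x y) (loop (π₂ x) y p)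
  where
  loop : ∀ k y → Rec (⟦ c ⟧ O) (⟦ d ⟧ O) (π₁ x) k y →
         Eventually λ s → Rec (Graph (step c (O ↾ s) s)) (Graph (step d (O ↾ s) s)) (π₁ x) k y
  loop zero    y p           = step-complete O c _ y p
  loop (suc k) y (v , p , q) =
    ev-map (λ s → v ,_) (ev-× (loop k v p) (step-complete O d _ y q))
step-complete O (min c)    x y (p , ps) =
  ev-map (λ s (y<s , ps) → minS⇐ (step c (O ↾ s) s) s x y y<s ps)
    (ev-× (suc y , λ s y<s → y<s)
      (ev-× (step-complete O c _ 0 p)
        (ev-∀< {λ z s → ∃ λ m → Graph (step c (O ↾ s) s) ⟨ x , z ⟩ (suc m)} y λ z z<y →
          let m , q = ps z z<y in
          ev-map (λ s → m ,_) (step-complete O c _ (suc m) q))))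

-- Both results appear at a common stage, and `step` is a function.
deterministic : ∀ (O : I → Real) c {x y z} → ⟦ c ⟧ O x y → ⟦ c ⟧ O x z → y ≡ z
deterministic O c p q
  with s , eqs ← ev-× (step-complete O c _ _ p) (step-complete O c _ _ q)
  with eq , eq′ ← eqs s ≤-refl = suc-injective (trans (sym eq) eq′)

-- Unbounded search and computably enumerable sets

leastZero : ∀ (t : ℕ → ℕ) k → t k ≡ 0 → ∃ λ m → t m ≡ 0 × (∀ z → z < m → t z ≢ 0)
leastZero t zero    eq = 0 , eq , λ z ()
leastZero t (suc k) eq with t 0 in eq₀
... | zero  = 0 , eq₀ , λ z ()
... | suc _ with m , eqₘ , below ← leastZero (t ∘ suc) k eq =
  suc m , eqₘ , λ { zero _ eq₀′ → 1+n≢0 (trans (sym eq₀) eq₀′) ; (suc z) (s≤s z<m) → below z z<m }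

nonzero : ∀ {k} → k ≢ 0 → k ≡ suc (pred k)
nonzero {zero}  k≢0 = ⊥-elim (k≢0 refl)
nonzero {suc k} _   = refl

search : {F : Fun K (suc n)} → Computes F → Code K
search f = min (program f)

module _ {F : Fun K (suc n)} (f : Computes F) {O : K → Real} {ρ : Env n} where

  search-finds : ∀ {y} → F O (ρ , y) ≡ 0 → (∀ z → z < y → F O (ρ , z) ≢ 0) →
                 ⟦ search f ⟧ O (enc ρ) y
  search-finds {y} eq below =
    subst (⟦ program f ⟧ O _) eq (correct f O (ρ , y)) ,
    λ z z<y → _ , subst (⟦ program f ⟧ O _) (nonzero (below z z<y)) (correct f O (ρ , z))

  search-halts : ∀ y → F O (ρ , y) ≡ 0 → ∃ λ m → ⟦ search f ⟧ O (enc ρ) m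
  search-halts y eq with m , eqₘ , below ← leastZero (λ y → F O (ρ , y)) y eq =
    m , search-finds eqₘ below

  search-zero : ∀ {y} → ⟦ search f ⟧ O (enc ρ) y → F O (ρ , y) ≡ 0
  search-zero (p , _) = deterministic O (program f) (correct f O (ρ , _)) p

CE-∃ : {G : Fun ⊥ 2} → Computes G → CE (λ m → ∃ λ t → G noOracle ((tt , m) , t) ≡ 0)
-- The empty environment is coded by 0, so the input `m` must first become `⟨ 0 , m ⟩`.
CE-∃ g = comp (search g) (pair const0 idCode) , λ m → mk⇔
  (λ (t , eq) → let y , p = search-halts g t eq in
    y , _ , (0 , m , refl , idCode-correct noOracle m , refl) , p)
  (λ { (y , _ , (_ , _ , refl , p , refl) , q) →
    y , search-zero g (subst (λ z → ⟦ search g ⟧ noOracle ⟨ 0 , z ⟩ y)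
          (deterministic noOracle idCode {m} p (idCode-correct noOracle m)) q) })

-- Lists of natural numbers

tails : ℕ → ℕ → ℕ
tails m = natrec m (λ _ r → π₂ (pred r))

-- A list as a finite partial function in the coding above, 0 beyond its end; thus a code of `[ τ ]`
-- serves directly as a partial oracle for `step`.
entry : ℕ → ℕ → ℕ
entry m j = ifz (tails m j) 0 (suc (π₁ (pred (tails m j))))

entryᶜ : {F G : Fun K n} → Computes F → Computes G → Computes (λ O ρ → entry (F O ρ) (G O ρ))
entryᶜ f g = ifzᶜ t zeroᶜ (sucᶜ (π₁ᶜ (predᶜ t)))
  where t = natrecᶜ f (π₂ᶜ (predᶜ varᶜ)) g

tails-suc : ∀ m j → tails m (suc j) ≡ tails (π₂ (pred m)) j
tails-suc m zero    = refl
tails-suc m (suc j) = cong (π₂ ∘ pred) (tails-suc m j)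

entry-[] : ∀ j → entry 0 j ≡ 0
entry-[] j = cong (λ k → ifz k 0 (suc (π₁ (pred k)))) (tails-0 j)
  where
  tails-0 : ∀ j → tails 0 j ≡ 0
  tails-0 zero    = refl
  tails-0 (suc j) rewrite tails-0 j = refl

entry-zero : ∀ x m → entry (suc ⟨ x , m ⟩) 0 ≡ suc x
entry-zero x m = cong suc (π₁-⟨,⟩ x m)

entry-suc : ∀ x m j → entry (suc ⟨ x , m ⟩) (suc j) ≡ entry m j
entry-suc x m j rewrite tails-suc (suc ⟨ x , m ⟩) j | π₂-⟨,⟩ x m = refl

entry-lookup : ∀ σ i → entry (encode σ) (toℕ i) ≡ suc (lookup σ i)
entry-lookup (x ∷ σ) zero    = entry-zero x (encode σ)
entry-lookup (x ∷ σ) (suc i) = trans (entry-suc x (encode σ) (toℕ i)) (entry-lookup σ i)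

entry-⊏ : ∀ σ {h} → σ ⊏ h → Graph (entry (encode σ)) ⊆₂ λ q v → v ≡ h q
entry-⊏ []      σ⊏h q       v eq = ⊥-elim (0≢1+n (trans (sym (entry-[] q)) eq))
entry-⊏ (x ∷ σ) σ⊏h zero    v eq =
  trans (suc-injective (trans (sym eq) (entry-zero x (encode σ)))) (σ⊏h zero)
entry-⊏ (x ∷ σ) σ⊏h (suc q) v eq =
  entry-⊏ σ (σ⊏h ∘ suc) q v (trans (sym (entry-suc x (encode σ) q)) eq)

applyUpTo-⊏ : ∀ h s → applyUpTo h s ⊏ h
applyUpTo-⊏ h s = lookup-applyUpTo h s

entry-applyUpTo : ∀ h s q → q < s → entry (encode (applyUpTo h s)) q ≡ suc (h q)
entry-applyUpTo h (suc s) zero    q<s       = entry-zero (h 0) (encode (applyUpTo (h ∘ suc) s))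
entry-applyUpTo h (suc s) (suc q) (s≤s q<s) =
  trans (entry-suc (h 0) (encode (applyUpTo (h ∘ suc) s)) q) (entry-applyUpTo (h ∘ suc) s q q<s)

-- Lets `matches` use the code itself as a bound in place of the length.
toℕ<encode : ∀ σ (i : Fin (length σ)) → toℕ i < encode σ
toℕ<encode (x ∷ σ) zero    = s≤s z≤n
toℕ<encode (x ∷ σ) (suc i) = s≤s (≤-trans (toℕ<encode σ i) (m≤n+m _ _))

encode-surjective : ∀ m → ∃ λ σ → encode σ ≡ m
encode-surjective m = decode m m ≤-refl
  where
  decode : ∀ k m → m ≤ k → ∃ λ σ → encode σ ≡ m
  decode k       zero    _         = [] , refl
  decode (suc k) (suc m) (s≤s m≤k) with σ , eq ← decode k (π₂ m) (≤-trans (π₂≤ m) m≤k) =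
    π₁ m ∷ σ , cong suc (trans (cong ⟨ π₁ m ,_⟩ eq) (⟨π₁,π₂⟩ m))

matches : ℕ → Real → ℕ
matches m h = sum< m (λ j → entry m j * dist (entry m j) (suc (h j)))

matchesᶜ : {F : Fun K n} (i : K) → Computes F → Computes (λ O ρ → matches (F O ρ) (O i))
matchesᶜ i f = sum<ᶜ f (e *ᶜ distᶜ e (sucᶜ (oracleᶜ i varᶜ)))
  where e = entryᶜ (wkᶜ f) varᶜ

matches⇒⊏ : ∀ σ {h} → matches (encode σ) h ≡ 0 → σ ⊏ h
matches⇒⊏ σ {h} eq i =
  suc-injective (dist≡0⇒≡ _ _ ([ (λ ()) , id ]′ (m*n≡0⇒m≡0∨n≡0 (suc (lookup σ i)) eqᵢ)))
  where
  eqᵢ : suc (lookup σ i) * dist (suc (lookup σ i)) (suc (h (toℕ i))) ≡ 0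
  eqᵢ = subst (λ e → e * dist e (suc (h (toℕ i))) ≡ 0) (entry-lookup σ i)
          (sum<≡0 (encode σ) _ eq (toℕ i) (toℕ<encode σ i))

⊏⇒matches : ∀ σ {h} → σ ⊏ h → matches (encode σ) h ≡ 0
⊏⇒matches σ {h} σ⊏h = sum<≡0⁻ (encode σ) _ λ j _ → lemma j
  where
  lemma : ∀ j → entry (encode σ) j * dist (entry (encode σ) j) (suc (h j)) ≡ 0
  lemma j with entry (encode σ) j in eq
  ... | zero  = refl
  ... | suc v =
    trans (cong (suc v *_) (≡⇒dist≡0 (cong suc (entry-⊏ σ σ⊏h j v eq)))) (*-zeroʳ (suc v))

-- Σ⁰₁ sets as the projections of computable tests

-- A natural number is handled as the constant real with that value.
embed : ∀ 𝒳 → Point 𝒳 → Real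
embed nat   n = λ _ → n
embed baire x = x

_&_ : Real → Real → Bool → Real
(h & x) true  = h
(h & x) false = x

code-surjective : ∀ 𝒳 m → ∃ λ b → code 𝒳 b ≡ m
code-surjective nat   m = m , refl
code-surjective baire m = encode-surjective m

inside : Space → ℕ → Real → ℕ
inside nat   m x = dist (x 0) m
inside baire m x = matches m x

insideᶜ : ∀ 𝒳 {F : Fun K n} (i : K) → Computes F → Computes (λ O ρ → inside 𝒳 (F O ρ) (O i))
insideᶜ nat   i f = distᶜ (oracleᶜ i zeroᶜ) f
insideᶜ baire i f = matchesᶜ i f

inside⇒Nbhd : ∀ 𝒳 b x → inside 𝒳 (code 𝒳 b) (embed 𝒳 x) ≡ 0 → Nbhd 𝒳 b x
inside⇒Nbhd nat   m x eq = dist≡0⇒≡ x m eq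
inside⇒Nbhd baire τ x eq = matches⇒⊏ τ eq

Nbhd⇒inside : ∀ 𝒳 b x → Nbhd 𝒳 b x → inside 𝒳 (code 𝒳 b) (embed 𝒳 x) ≡ 0
Nbhd⇒inside nat   m x eq  = ≡⇒dist≡0 eq
Nbhd⇒inside baire τ x τ⊏x = ⊏⇒matches τ τ⊏x

Projection : ∀ 𝒳 → Fun Bool 1 → Pred (Real × Point 𝒳) 0ℓ
Projection 𝒳 F (h , x) = ∃ λ t → F (h & embed 𝒳 x) (tt , t) ≡ 0

noPartial : ⊥ → ℕ → ℕ
noPartial ()

-- A witness is a code `m` with a stage at which `m` is seen to be enumerated; whether the point
-- lies in the basic set `m` is then decidable.
Σ⁰₁⇒Projection : ∀ 𝒳 {S} → Σ⁰₁ 𝒳 S → ∃ λ F → Computes F × S ≐ Projection 𝒳 F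
Σ⁰₁⇒Projection 𝒳 {S} (W , (c , W⇔) , S⊆ , ⊆S) = F , Fᶜ , forth , back
  where
  test : ℕ → ℕ → (Bool → Real) → ℕ
  test m s O =
    isZero (step c noPartial s m) + (matches (π₁ m) (O true) + inside 𝒳 (π₂ m) (O false))
  F : Fun Bool 1
  F O (_ , t) = test (π₁ t) (π₂ t) O
  Fᶜ : Computes F
  Fᶜ = isZeroᶜ (letᶜ (stepᶜ c {λ i _ _ → noPartial i} (λ ()) (π₂ᶜ varᶜ)) (π₁ᶜ varᶜ))
       +ᶜ (matchesᶜ true (π₁ᶜ (π₁ᶜ varᶜ)) +ᶜ insideᶜ 𝒳 false (π₂ᶜ (π₁ᶜ varᶜ)))
  forth : ∀ {p} → S p → Projection 𝒳 F p
  forth {h , x} Sp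
    with σ , b , σb∈W , σ⊏h , x∈b ← S⊆ Sp
    with y , p ← Equivalence.to (W⇔ ⟨ encode σ , code 𝒳 b ⟩) σb∈W
    with s , eq ← step-complete noOracle c _ y p =
    ⟨ m , s ⟩ , trans (cong₂ (λ m s → test m s (h & embed 𝒳 x)) (π₁-⟨,⟩ m s) (π₂-⟨,⟩ m s))
      (cong₂ _+_ (cong isZero (step-mono {ψ′ = noPartial} (λ ()) ≤-refl c m y (eq s ≤-refl)))
        (cong₂ _+_
          (trans (cong (λ k → matches k h) (π₁-⟨,⟩ (encode σ) (code 𝒳 b))) (⊏⇒matches σ σ⊏h))
          (trans (cong (λ k → inside 𝒳 k (embed 𝒳 x)) (π₂-⟨,⟩ (encode σ) (code 𝒳 b)))
                 (Nbhd⇒inside 𝒳 b x x∈b))))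
    where m = ⟨ encode σ , code 𝒳 b ⟩
  back : ∀ {p} → Projection 𝒳 F p → S p
  back {h , x} (t , eq)
    -- Every number is the code of some basic open set.
    with σ , σ≡ ← encode-surjective (π₁ (π₁ t))
    with b , b≡ ← code-surjective 𝒳 (π₂ (π₁ t)) =
    ⊆S (σ , b ,
        subst W (sym (trans (cong₂ ⟨_,_⟩ σ≡ b≡) (⟨π₁,π₂⟩ (π₁ t))))
          (Equivalence.from (W⇔ (π₁ t))
            (_ , step-sound (λ ()) c (π₂ t) (π₁ t) _
                   (nonzero (isZero-true (m+n≡0⇒m≡0 _ eq))))) ,
        matches⇒⊏ σ (subst (λ k → matches k h ≡ 0) (sym σ≡) (m+n≡0⇒m≡0 _ eq′)) ,
        inside⇒Nbhd 𝒳 b x (subst (λ k → inside 𝒳 k (embed 𝒳 x) ≡ 0) (sym b≡)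
          (m+n≡0⇒n≡0 (matches (π₁ (π₁ t)) h) eq′)))
    where
    eq′ = m+n≡0⇒n≡0 (isZero (step c noPartial (π₂ t) (π₁ t))) eq

-- The partial oracle given by a basic set: `{ n }` determines the whole constant real, `[ τ ]` only
-- the entries of `τ`.
value : Space → ℕ → ℕ → ℕ
value nat   m q = suc m
value baire m q = entry m q

valueᶜ : ∀ 𝒳 {F G : Fun K n} → Computes F → Computes G →
         Computes (λ O ρ → value 𝒳 (F O ρ) (G O ρ))
valueᶜ nat   f g = sucᶜ f
valueᶜ baire f g = entryᶜ f g

value-Nbhd : ∀ 𝒳 b x → Nbhd 𝒳 b x → Graph (value 𝒳 (code 𝒳 b)) ⊆₂ λ q v → v ≡ embed 𝒳 x q
value-Nbhd nat   m x refl q v eq = suc-injective (sym eq)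
value-Nbhd baire τ x τ⊏x  = entry-⊏ τ τ⊏x

value-complete : ∀ 𝒳 x s → ∃ λ b → Nbhd 𝒳 b x ×
                 (∀ q → q < s → value 𝒳 (code 𝒳 b) q ≡ suc (embed 𝒳 x q))
value-complete nat   x s = x , refl , λ q _ → refl
value-complete baire x s = applyUpTo x s , applyUpTo-⊏ x s , entry-applyUpTo x s

-- By the use principle a successful search for a witness uses finite information only; the family
-- consists of the codes whose information already makes it halt.
Projection⇒Σ⁰₁ : ∀ 𝒳 {F S} → Computes F → S ≐ Projection 𝒳 F → Σ⁰₁ 𝒳 S
Projection⇒Σ⁰₁ 𝒳 {F} {S} f (S⊆ , ⊆S) =
  _ , CE-∃ Gᶜ , (λ {p} Sp → forth (S⊆ {p} Sp)) , λ {p} q → ⊆S {p} (back q)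
  where
  known : ℕ → Bool → ℕ → ℕ
  known m true  q = entry (π₁ m) q
  known m false q = value 𝒳 (π₂ m) q
  G : Fun ⊥ 2
  G _ ((_ , m) , s) = isZero (step (search f) (known m) s 0)
  Gᶜ : Computes G
  Gᶜ = isZeroᶜ (letᶜ (stepᶜ (search f) {λ i _ ρ q → known (proj₂ (proj₁ ρ)) i q} knownᶜ varᶜ) zeroᶜ)
    where
    knownᶜ : ∀ i → Computes {n = 3} (λ O ρ → known (proj₂ (proj₁ (proj₁ ρ))) i (proj₂ ρ))
    knownᶜ true  = entryᶜ (π₁ᶜ (wkᶜ (wkᶜ varᶜ))) varᶜ
    knownᶜ false = valueᶜ 𝒳 (π₂ᶜ (wkᶜ (wkᶜ varᶜ))) varᶜ
  W : Pred ℕ 0ℓ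
  W m = ∃ λ s → G noOracle ((tt , m) , s) ≡ 0
  forth : ∀ {p} → Projection 𝒳 F p → ⋃Basic 𝒳 W p
  forth {h , x} (t , eq)
    with y , p ← search-halts f {ρ = tt} t eq
    with s , eqs ← step-complete (h & embed 𝒳 x) (search f) 0 y p
    with b , x∈b , valueᵇ ← value-complete 𝒳 x s =
    σ , b , (s , cong isZero (step-mono {s = s} sub ≤-refl (search f) 0 y (eqs s ≤-refl))) ,
    applyUpTo-⊏ h s , x∈b
    where
    σ = applyUpTo h s
    m = ⟨ encode σ , code 𝒳 b ⟩
    sub : ∀ i → Graph (((h & embed 𝒳 x) ↾ s) i) ⊆₂ Graph (known m i)
    sub i q v eq with q<s , refl ← ↾-sound (h & embed 𝒳 x) s i q v eq = defined i
      where
      defined : ∀ i → Graph (known m i) q ((h & embed 𝒳 x) i q)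
      defined true  rewrite π₁-⟨,⟩ (encode σ) (code 𝒳 b) = entry-applyUpTo h s q q<s
      defined false rewrite π₂-⟨,⟩ (encode σ) (code 𝒳 b) = valueᵇ q q<s
  back : ∀ {p} → ⋃Basic 𝒳 W p → Projection 𝒳 F p
  back {h , x} (σ , b , (s , eq) , σ⊏h , x∈b) =
    _ , search-zero f {ρ = tt} (step-sound sub (search f) s 0 _ (nonzero (isZero-true eq)))
    where
    sub : ∀ i → Graph (known ⟨ encode σ , code 𝒳 b ⟩ i) ⊆₂ λ q v → v ≡ (h & embed 𝒳 x) i q
    sub true  rewrite π₁-⟨,⟩ (encode σ) (code 𝒳 b) = entry-⊏ σ σ⊏h
    sub false rewrite π₂-⟨,⟩ (encode σ) (code 𝒳 b) = value-Nbhd 𝒳 b x x∈b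

-- Membership rests on finitely many values of the oracle, so pointwise equality of oracles is
-- enough.
Σ⁰₁-resp : ∀ 𝒳 {S} → Σ⁰₁ 𝒳 S → ∀ {h h′ x} → (∀ n → h n ≡ h′ n) → S (h , x) → S (h′ , x)
Σ⁰₁-resp 𝒳 (W , _ , S⊆ , ⊆S) h≗h′ Sh with σ , b , σb∈W , σ⊏h , x∈b ← S⊆ Sh =
  ⊆S (σ , b , σb∈W , (λ i → trans (σ⊏h i) (h≗h′ (toℕ i))) , x∈b)

-- If N recognises that its first argument differs from f, then a pair of Σ⁰₁
-- sets with complementary f-sections is turned into a pair of complementary
-- sets: U or N against V, the first to be confirmed wins.
module Reduction (em : ExcludedMiddle 0ℓ) (𝒳 : Space) {f : Real} {N : Fun Bool 1}
  (Nᶜ : Computes N)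
  (N-sound : ∀ x t → N (f & x) (tt , t) ≢ 0)
  (N-complete : ∀ h x → (∀ t → N (h & x) (tt , t) ≢ 0) → ∀ n → h n ≡ f n)
  where

  module _ {P : Pred (Point 𝒳) 0ℓ} {S S′}
    (ΣS : Σ⁰₁ 𝒳 S) (P≐S : P ≐ section 𝒳 S f)
    (ΣS′ : Σ⁰₁ 𝒳 S′) (∁P≐S′ : ∁ P ≐ section 𝒳 S′ f)
    {U V : Fun Bool 1} (Uᶜ : Computes U) (S≐U : S ≐ Projection 𝒳 U)
    (Vᶜ : Computes V) (S′≐V : S′ ≐ Projection 𝒳 V)
    where

    private
      A stop : Fun Bool 1
      A O ρ = U O ρ * N O ρ
      stop O ρ = A O ρ * V O ρ

      -- Both sets look at the first stage at which `A` or `V` is confirmed; a tie goes to `A`,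
      -- through `isZero (A O ρ)` in `F₂`.
      first F₁ F₂ : Fun Bool 1
      first O (_ , t) = sum< t λ j → isZero (stop O (tt , j))
      F₁ O ρ = A O ρ + first O ρ
      F₂ O ρ = isZero (A O ρ) + (V O ρ + first O ρ)

      Aᶜ : Computes A
      Aᶜ = Uᶜ *ᶜ Nᶜ

      firstᶜ : Computes first
      firstᶜ = sum<ᶜ varᶜ (isZeroᶜ (substᶜ (λ O ρ → tt , proj₂ ρ) (Aᶜ *ᶜ Vᶜ) (pairᶜ zeroᶜ varᶜ)))

    module _ (O : Bool → Real) where

      private
        U-stops : ∀ {t} → U O (tt , t) ≡ 0 → stop O (tt , t) ≡ 0
        U-stops {t} eq = cong (λ u → u * N O (tt , t) * V O (tt , t)) eq

        A-stops : ∀ {t} → A O (tt , t) ≡ 0 → stop O (tt , t) ≡ 0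
        A-stops {t} eq = cong (_* V O (tt , t)) eq

        N-stops : ∀ {t} → N O (tt , t) ≡ 0 → stop O (tt , t) ≡ 0
        N-stops {t} eq = A-stops (trans (cong (U O (tt , t) *_) eq) (*-zeroʳ (U O (tt , t))))

        V-stops : ∀ {t} → V O (tt , t) ≡ 0 → stop O (tt , t) ≡ 0
        V-stops {t} eq = trans (cong (A O (tt , t) *_) eq) (*-zeroʳ (A O (tt , t)))

      decide : ∀ t → stop O (tt , t) ≡ 0 → (∃ λ t → F₁ O (tt , t) ≡ 0) ⊎ (∃ λ t → F₂ O (tt , t) ≡ 0)
      decide t eq
        with m , eqₘ , below ← leastZero (λ t → stop O (tt , t)) t eq
        with firstₘ ← sum<≡0⁻ m (λ j → isZero (stop O (tt , j)))
                        (λ z z<m → isZero-false (below z z<m))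
        with A O (tt , m) in a
      ... | zero  = inj₁ (m , cong₂ _+_ a firstₘ)
      ... | suc k = inj₂ (m , cong₂ _+_ (cong isZero a)
              (cong₂ _+_ ([ (λ ()) , id ]′ (m*n≡0⇒m≡0∨n≡0 (suc k) eqₘ)) firstₘ))

      module _ {t} (eq : F₁ O (tt , t) ≡ 0) where
        F₁⇒A : A O (tt , t) ≡ 0
        F₁⇒A = m+n≡0⇒m≡0 (A O (tt , t)) eq
        F₁⇒first : ∀ j → j < t → stop O (tt , j) ≢ 0
        F₁⇒first j j<t = isZero-true (sum<≡0 t (λ j → isZero (stop O (tt , j)))
          (m+n≡0⇒n≡0 (A O (tt , t)) eq) j j<t)

      module _ {t} (eq : F₂ O (tt , t) ≡ 0) where
        private
          eq′ = m+n≡0⇒n≡0 (isZero (A O (tt , t))) eq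
        F₂⇒¬A : A O (tt , t) ≢ 0
        F₂⇒¬A = isZero-true (m+n≡0⇒m≡0 (isZero (A O (tt , t))) eq)
        F₂⇒V : V O (tt , t) ≡ 0
        F₂⇒V = m+n≡0⇒m≡0 (V O (tt , t)) eq′
        F₂⇒first : ∀ j → j < t → stop O (tt , j) ≢ 0
        F₂⇒first j j<t = isZero-true (sum<≡0 t (λ j → isZero (stop O (tt , j)))
          (m+n≡0⇒n≡0 (V O (tt , t)) eq′) j j<t)

      exclusive : ∀ t t′ → F₁ O (tt , t) ≡ 0 → F₂ O (tt , t′) ≡ 0 → ⊥
      exclusive t t′ eq eq′ with <-cmp t t′
      ... | tri< t<t′ _ _ = F₂⇒first eq′ t t<t′ (A-stops (F₁⇒A eq))
      ... | tri≈ _ refl _ = F₂⇒¬A eq′ (F₁⇒A eq)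
      ... | tri> _ _ t′<t = F₁⇒first eq t′ t′<t (V-stops (F₂⇒V eq′))

      -- Either `N` speaks, or `h` agrees with `f` and the complementary sections settle `x`.
      stops : ∀ h x → O ≡ h & embed 𝒳 x → ∃ λ t → stop O (tt , t) ≡ 0
      stops h x refl with em {∃ λ t → N O (tt , t) ≡ 0}
      ... | yes (t , eq) = t , N-stops eq
      ... | no never with h≗f ← N-complete h (embed 𝒳 x) (λ t eq → never (t , eq)) | em {P x}
      ...   | yes Px =
        let t , eq = proj₁ S≐U (Σ⁰₁-resp 𝒳 ΣS (sym ∘ h≗f) (proj₁ P≐S Px)) in t , U-stops eq
      ...   | no ¬Px =
        let t , eq = proj₁ S′≐V (Σ⁰₁-resp 𝒳 ΣS′ (sym ∘ h≗f) (proj₁ ∁P≐S′ ¬Px)) in t , V-stops eq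

    Q-separates : ∃ λ Q → Δ⁰₁ 𝒳 Q × P ≐ section 𝒳 Q f
    Q-separates =
      Projection 𝒳 F₁ ,
      (Projection⇒Σ⁰₁ 𝒳 (Aᶜ +ᶜ firstᶜ) (id , id) ,
       Projection⇒Σ⁰₁ 𝒳 (isZeroᶜ Aᶜ +ᶜ (Vᶜ +ᶜ firstᶜ))
         ((λ {p} → forth {p}) , λ { {p} (t′ , eq′) (t , eq) → exclusive (orc p) t t′ eq eq′ })) ,
      P⊆Q , Q⊆P
      where
      orc : Real × Point 𝒳 → Bool → Real
      orc (h , x) = h & embed 𝒳 x
      total : ∀ p → Projection 𝒳 F₁ p ⊎ Projection 𝒳 F₂ p
      total p@(h , x) = let t , eq = stops (orc p) h x refl in decide (orc p) t eq
      forth : ∀ {p} → ¬ Projection 𝒳 F₁ p → Projection 𝒳 F₂ p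
      forth {p} ¬Q = [ ⊥-elim ∘ ¬Q , id ]′ (total p)
      P⊆Q : ∀ {x} → P x → Projection 𝒳 F₁ (f , x)
      P⊆Q {x} Px with total (f , x)
      ... | inj₁ q        = q
      ... | inj₂ (t , eq) = ⊥-elim (proj₂ ∁P≐S′ (proj₂ S′≐V (t , F₂⇒V (orc (f , x)) eq)) Px)
      Q⊆P : ∀ {x} → Projection 𝒳 F₁ (f , x) → P x
      -- `A` is a disjunction, and its half `N` never holds at `f`.
      Q⊆P {x} (t , eq) with m*n≡0⇒m≡0∨n≡0 (U (orc (f , x)) (tt , t)) (F₁⇒A (orc (f , x)) eq)
      ... | inj₁ u = proj₂ P≐S (proj₂ S≐U (t , u))
      ... | inj₂ v = ⊥-elim (N-sound _ t v)

  stronglyRelativizes : StronglyRelativizesΔ⁰₁At 𝒳 f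
  stronglyRelativizes P ((S , ΣS , P≐S) , (S′ , ΣS′ , ∁P≐S′)) =
    separate (Σ⁰₁⇒Projection 𝒳 ΣS) (Σ⁰₁⇒Projection 𝒳 ΣS′)
    where
    separate : (∃ λ U → Computes U × S ≐ Projection 𝒳 U) →
               (∃ λ V → Computes V × S′ ≐ Projection 𝒳 V) →
               ∃ λ Q → Δ⁰₁ 𝒳 Q × P ≐ section 𝒳 Q f
    separate (U , Uᶜ , S≐U) (V , Vᶜ , S′≐V) = Q-separates ΣS P≐S ΣS′ ∁P≐S′ Uᶜ S≐U Vᶜ S′≐V

-- The universal function

-- Evaluates the outermost constructor, with the tags of `number`; every tag from 7 on means
-- `right`, so that each number is a program. Since smaller tags have been excluded, `t ∸ j`
-- vanishes only for `t = j`.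
node : ℕ → ℕ → (g h : ℕ → ℕ) → ℕ → ℕ
node t s g h x =
  ifz t (pairS g h x) (ifz (t ∸ 1) (compS g h x) (ifz (t ∸ 2) (precS g h x)
    (ifz (t ∸ 3) (minS s g x) (ifz (t ∸ 4) 1 (ifz (t ∸ 5) (suc (suc x)) (ifz (t ∸ 6) (suc (π₁ x)) (suc (π₂ x))))))))

constᶜ : ∀ k → Computes {K} {n} (λ O ρ → k)
constᶜ zero    = zeroᶜ
constᶜ (suc k) = sucᶜ (constᶜ k)

nodeᶜ : {T S : Fun K n} {g h : (K → Real) → Env n → ℕ → ℕ} → Computes T → Computes S →
        Computes {n = suc n} (λ O ρ → g O (proj₁ ρ) (proj₂ ρ)) →
        Computes {n = suc n} (λ O ρ → h O (proj₁ ρ) (proj₂ ρ)) →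
        Computes {n = suc n} (λ O ρ → node (T O (proj₁ ρ)) (S O (proj₁ ρ))
                                        (g O (proj₁ ρ)) (h O (proj₁ ρ)) (proj₂ ρ))
nodeᶜ tᶜ s g h =
  ifzᶜ t (pairSᶜ g h) (ifzᶜ (t ∸ᶜ constᶜ 1) (compSᶜ g h) (ifzᶜ (t ∸ᶜ constᶜ 2) (precSᶜ g h)
    (ifzᶜ (t ∸ᶜ constᶜ 3) (minSᶜ g s) (ifzᶜ (t ∸ᶜ constᶜ 4) (constᶜ 1)
      (ifzᶜ (t ∸ᶜ constᶜ 5) (sucᶜ (sucᶜ varᶜ))
        (ifzᶜ (t ∸ᶜ constᶜ 6) (sucᶜ (π₁ᶜ varᶜ)) (sucᶜ (π₂ᶜ varᶜ))))))))
  where t = wkᶜ tᶜ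

node-mono : ∀ t {s} → Graph g ⊆₂ Graph g′ → Graph h ⊆₂ Graph h′ →
            Graph (node t s g h) ⊆₂ Graph (node t s g′ h′)
node-mono 0 p q = pairS-mono p q
node-mono 1 p q = compS-mono p q
node-mono 2 p q = precS-mono p q
node-mono 3 {s} p q = minS-mono {s = s} ≤-refl p
node-mono 4 p q x y eq = eq
node-mono 5 p q x y eq = eq
node-mono 6 p q x y eq = eq
node-mono (suc (suc (suc (suc (suc (suc (suc _))))))) p q x y eq = eq

≡-by-suc : ∀ (a b : ℕ) → (∀ y → a ≡ suc y → b ≡ suc y) → (∀ y → b ≡ suc y → a ≡ suc y) → a ≡ b
≡-by-suc zero    zero    p q = refl
≡-by-suc zero    (suc b) p q = q b refl
≡-by-suc (suc a) b       p q = sym (p a refl)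

node-cong : ∀ t s {g g′ h h′} → (∀ x → g x ≡ g′ x) → (∀ x → h x ≡ h′ x) →
            ∀ x → node t s g h x ≡ node t s g′ h′ x
node-cong t s {g} {g′} {h} {h′} p q x = ≡-by-suc _ _
  (node-mono {g} {g′} {h} {h′} t {s} (λ x y → trans (sym (p x))) (λ x y → trans (sym (q x))) x)
  (node-mono {g′} {g} {h′} {h} t {s} (λ x y → trans (p x)) (λ x y → trans (q x)) x)

number : Code ⊥ → ℕ
number (pair c d) = ⟨ 0 , ⟨ number c , number d ⟩ ⟩
number (comp c d) = ⟨ 1 , ⟨ number c , number d ⟩ ⟩
number (prec c d) = ⟨ 2 , ⟨ number c , number d ⟩ ⟩
number (min c)    = ⟨ 3 , ⟨ number c , 0 ⟩ ⟩
number const0     = ⟨ 4 , ⟨ 0 , 0 ⟩ ⟩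
number succ       = ⟨ 5 , ⟨ 0 , 0 ⟩ ⟩
number left       = ⟨ 6 , ⟨ 0 , 0 ⟩ ⟩
number right      = ⟨ 7 , ⟨ 0 , 0 ⟩ ⟩
number (oracle ())

module Universal (em : ExcludedMiddle 0ℓ) where

  -- The noncomputable ingredient: some stage at which the search succeeds, if there is one.
  bound : (ℕ → ℕ) → ℕ → ℕ
  bound g x with em {∃₂ λ s y → Graph (minS s g) x y}
  ... | yes (s , _) = s
  ... | no  _       = 0

  bound-complete : ∀ g x y → MinR (Graph g) x y → Graph (minS (bound g x) g) x y
  bound-complete g x y p with em {∃₂ λ s y → Graph (minS s g) x y}
  ... | no none = ⊥-elim (none (suc y , y , minS⇐ g (suc y) x y ≤-refl p))
  ... | yes (s , y′ , eq) = trans eq (trans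
    (sym (minS-mono {g} (m≤m⊔n s (suc y)) (λ x y → id) x y′ eq))
    (minS⇐ g (s ⊔ suc y) x y (m≤n⊔m s (suc y)) p))

  -- A value `suc y` is found again at every stage from `suc y` on, and the value 0 means that no
  -- stage succeeds. So the value, taken as a stage with any surplus `s`, reproduces itself.
  minS-stationary : ∀ g x s → minS (minS (bound g x) g x + s) g x ≡ minS (bound g x) g x
  minS-stationary g x s with minS (bound g x) g x in eq
  ... | suc y = minS⇐ g (suc y + s) x y (m≤m+n (suc y) s) (proj₂ (minS⇒ g (bound g x) x y eq))
  ... | zero with minS s g x in eq′
  ...   | zero  = refl
  ...   | suc y = ⊥-elim (0≢1+n (trans (sym eq)
                    (bound-complete g x y (proj₂ (minS⇒ g s x y eq′)))))

  -- The programs of depth at most k; bounding the depth makes the defining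
  -- equations of the values at level suc k refer to level k only.
  U : ℕ → ℕ → ℕ → ℕ
  U zero    e x = 0
  U (suc k) e x = node (π₁ e) (bound (U k (π₁ (π₂ e))) x) (U k (π₁ (π₂ e))) (U k (π₂ (π₂ e))) x

  node-stationary : ∀ t g h x s → let v = node t (bound g x) g h x in node t (v + s) g h x ≡ v
  node-stationary 0 g h x s = refl
  node-stationary 1 g h x s = refl
  node-stationary 2 g h x s = refl
  node-stationary 3 g h x s = minS-stationary g x s
  node-stationary 4 g h x s = refl
  node-stationary 5 g h x s = refl
  node-stationary 6 g h x s = refl
  node-stationary (suc (suc (suc (suc (suc (suc (suc _))))))) g h x s = refl

  U-number : ∀ k t a b x →
             U (suc k) ⟨ t , ⟨ a , b ⟩ ⟩ x ≡ node t (bound (U k a) x) (U k a) (U k b) x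
  U-number k t a b x
    rewrite π₁-⟨,⟩ t ⟨ a , b ⟩ | π₂-⟨,⟩ t ⟨ a , b ⟩ | π₁-⟨,⟩ a b | π₂-⟨,⟩ a b = refl

  ev-suc : Eventually P → (∀ k → P k → Q (suc k)) → Eventually Q
  ev-suc (k₀ , p) f = suc k₀ , λ { (suc k) (s≤s le) → f k (p k le) }

  -- The level has to exceed the depth of `c`.
  universal : ∀ c → Eventually (λ k → ⟦ c ⟧ noOracle ⊆₂ Graph (U k (number c)))
  universal const0     = ev-suc (always λ k → tt) λ { k _ x y refl → U-number k 4 0 0 x }
  universal succ       = ev-suc (always λ k → tt) λ { k _ x y refl → U-number k 5 0 0 x }
  universal left       = ev-suc (always λ k → tt) λ { k _ x y refl → U-number k 6 0 0 x }
  universal right      = ev-suc (always λ k → tt) λ { k _ x y refl → U-number k 7 0 0 x }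
  universal (oracle ())
  universal (pair c d) = ev-suc (ev-× (universal c) (universal d)) λ k (p , q) x y r →
    trans (U-number k 0 (number c) (number d) x)
      (pairS⇐ (U k (number c)) (U k (number d)) x y (PairR-mono p q x y r))
  universal (comp c d) = ev-suc (ev-× (universal c) (universal d)) λ k (p , q) x y r →
    trans (U-number k 1 (number c) (number d) x)
      (compS⇐ (U k (number c)) (U k (number d)) x y (CompR-mono p q x y r))
  universal (prec c d) = ev-suc (ev-× (universal c) (universal d)) λ k (p , q) x y r →
    trans (U-number k 2 (number c) (number d) x)
      (precS⇐ (U k (number c)) (U k (number d)) x y (PrecR-mono p q x y r))
  universal (min c)    = ev-suc (universal c) λ k p x y r →
    trans (U-number k 3 (number c) 0 x)
      (bound-complete (U k (number c)) x y (MinR-mono p x y r))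

  f : Real
  f n = U (π₁ (π₁ n)) (π₂ (π₁ n)) (π₂ n)

  f-⟨⟩ : ∀ k e x → f ⟨ ⟨ k , e ⟩ , x ⟩ ≡ U k e x
  f-⟨⟩ k e x rewrite π₁-⟨,⟩ ⟨ k , e ⟩ x | π₂-⟨,⟩ ⟨ k , e ⟩ x | π₁-⟨,⟩ k e | π₂-⟨,⟩ k e = refl

  -- An index packs a sufficient level together with the program number.
  index : ∀ c → ∃ λ i → ∀ x y → ⟦ c ⟧ noOracle x y → f ⟨ i , x ⟩ ≡ suc y
  index c with k , p ← universal c =
    ⟨ k , number c ⟩ , λ x y r → trans (f-⟨⟩ k (number c) x) (p k ≤-refl x y r)

  next : Real → ℕ → ℕ → ℕ → ℕ → ℕ
  next h k e s =
    node (π₁ e) s (λ z → h ⟨ ⟨ k , π₁ (π₂ e) ⟩ , z ⟩) (λ z → h ⟨ ⟨ k , π₂ (π₂ e) ⟩ , z ⟩)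

  -- Adding s to the value turns both "a search that fails never succeeds" and
  -- "a search that finds y has found it by stage y + 1" into one condition.
  local : Real → ℕ → ℕ → ℕ → ℕ → ℕ
  local h k e x s = dist (next h k e (v + s) x) v + h ⟨ ⟨ 0 , e ⟩ , x ⟩
    where v = h ⟨ ⟨ suc k , e ⟩ , x ⟩

  f-local : ∀ k e x s → local f k e x s ≡ 0
  f-local k e x s rewrite f-⟨⟩ (suc k) e x | f-⟨⟩ 0 e x =
    cong (_+ 0) (≡⇒dist≡0 (trans
      (node-cong (π₁ e) (U (suc k) e x + s) {g′ = U k (π₁ (π₂ e))} {h′ = U k (π₂ (π₂ e))}
        (f-⟨⟩ k _) (f-⟨⟩ k _) x)
      (node-stationary (π₁ e) (U k (π₁ (π₂ e))) (U k (π₂ (π₂ e))) x s)))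

  -- Induction on the level; the second summand of `local` fixes level 0. Above it, let `u` be the
  -- true value and `v` that of `h`. The stage `u + v` is a surplus over both, so there each
  -- reproduces itself, while both are computed from the same lower level; hence `u = v`.
  local-unique : ∀ h → (∀ k e x s → local h k e x s ≡ 0) → ∀ k e x → h ⟨ ⟨ k , e ⟩ , x ⟩ ≡ U k e x
  local-unique h ok zero    e x = m+n≡0⇒n≡0 _ (ok 0 e x 0)
  local-unique h ok (suc k) e x =
    trans (sym (h-fixed u)) (trans (cong (λ s → next h k e s x) (+-comm v u)) (trans
      (node-cong (π₁ e) (u + v) {g′ = U k (π₁ (π₂ e))} {h′ = U k (π₂ (π₂ e))}
        (local-unique h ok k _) (local-unique h ok k _) x)
      (node-stationary (π₁ e) (U k (π₁ (π₂ e))) (U k (π₂ (π₂ e))) x v)))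
    where
    u = U (suc k) e x
    v = h ⟨ ⟨ suc k , e ⟩ , x ⟩
    h-fixed : ∀ s → next h k e (v + s) x ≡ v
    h-fixed s = dist≡0⇒≡ _ _ (m+n≡0⇒m≡0 _ (ok k e x s))

  differs : Fun Bool 1
  differs O (_ , t) =
    isZero (local (O true) (π₁ (π₁ t)) (π₂ (π₁ t)) (π₁ (π₂ t)) (π₂ (π₂ t)))

  differsᶜ : Computes differs
  differsᶜ = isZeroᶜ (distᶜ (letᶜ next′ x) v +ᶜ at zeroᶜ e x)
    where
    at : ∀ {m} {F G H : Fun Bool m} → Computes F → Computes G → Computes H →
         Computes (λ O ρ → O true ⟨ ⟨ F O ρ , G O ρ ⟩ , H O ρ ⟩)
    at a b c = oracleᶜ true (pairᶜ (pairᶜ a b) c)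
    k = π₁ᶜ (π₁ᶜ varᶜ)
    e = π₂ᶜ (π₁ᶜ varᶜ)
    x = π₁ᶜ (π₂ᶜ varᶜ)
    v = at (sucᶜ k) e x
    next′ = nodeᶜ (π₁ᶜ e) (v +ᶜ π₂ᶜ (π₂ᶜ varᶜ))
              (at (wkᶜ k) (wkᶜ (π₁ᶜ (π₂ᶜ e))) varᶜ) (at (wkᶜ k) (wkᶜ (π₂ᶜ (π₂ᶜ e))) varᶜ)

  f-stronglyRelativizes : ∀ 𝒳 → StronglyRelativizesΔ⁰₁At 𝒳 f
  f-stronglyRelativizes 𝒳 = Reduction.stronglyRelativizes em 𝒳 differsᶜ
    (λ x t eq → isZero-true eq (f-local (π₁ (π₁ t)) (π₂ (π₁ t)) (π₁ (π₂ t)) (π₂ (π₂ t))))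
    same
    where
    zero? : ∀ k → isZero k ≢ 0 → k ≡ 0
    zero? zero    _ = refl
    zero? (suc _) p = ⊥-elim (p refl)
    same : ∀ h x → (∀ t → differs (h & x) (tt , t) ≢ 0) → ∀ n → h n ≡ f n
    same h x never n =
      trans (cong h (sym (trans (cong ⟨_, π₂ n ⟩ (⟨π₁,π₂⟩ (π₁ n))) (⟨π₁,π₂⟩ n))))
            (local-unique h ok (π₁ (π₁ n)) (π₂ (π₁ n)) (π₂ n))
      where
      ok : ∀ k e x s → local h k e x s ≡ 0
      ok k e x s with p ← zero? _ (never ⟨ ⟨ k , e ⟩ , ⟨ x , s ⟩ ⟩)
        rewrite π₁-⟨,⟩ ⟨ k , e ⟩ ⟨ x , s ⟩ | π₂-⟨,⟩ ⟨ k , e ⟩ ⟨ x , s ⟩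
              | π₁-⟨,⟩ k e | π₂-⟨,⟩ k e | π₁-⟨,⟩ x s | π₂-⟨,⟩ x s = p

  -- If `h` is a computable bound and `i` an index of `x ↦ h ⟨ x , x ⟩ + 1`, then `f ⟨ i , i ⟩` is
  -- `h ⟨ i , i ⟩ + 2`: one successor from the program, one from the coding of definedness.
  f-not-dominated : ¬ ComputablyDominated f
  f-not-dominated dominated = refute (dominated f (oracle tt , λ n → refl))
    where
    refute : (∃ λ h → Computable h × (∀ n → f n ≤ h n)) → ⊥
    refute (h , (c , cʰ) , f≤h) = diagonal (index (comp succ (comp c (pair idCode idCode))))
      where
      correctᵈ : ∀ x → ⟦ comp succ (comp c (pair idCode idCode)) ⟧ noOracle x (suc (h ⟨ x , x ⟩))
      correctᵈ x = h ⟨ x , x ⟩ , (⟨ x , x ⟩ ,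
        (x , x , idCode-correct noOracle x , idCode-correct noOracle x , refl) ,
        cʰ ⟨ x , x ⟩) , refl
      diagonal : (∃ λ i → ∀ x y → ⟦ comp succ (comp c (pair idCode idCode)) ⟧ noOracle x y →
                          f ⟨ i , x ⟩ ≡ suc y) → ⊥
      diagonal (i , p) = <⇒≱ (n<1+n (h ⟨ i , i ⟩))
        (≤-trans (n≤1+n _) (subst (_≤ h ⟨ i , i ⟩) (p i _ (correctᵈ i)) (f≤h ⟨ i , i ⟩)))


-- Compactness of Cantor space

cons : Fin 2 → Cantor → Cantor
cons b X zero    = b
cons b X (suc n) = X n

module Compactness (em : ExcludedMiddle 0ℓ) where

  Uniform : (Cantor → ℕ → Set) → Set
  Uniform T = ∃ λ s → ∀ X → T X s

  record Regular (T : Cantor → ℕ → Set) : Set where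
    field
      pointwise : ∀ {X Y s} → (∀ n → X n ≡ Y n) → T X s → T Y s
      mono : ∀ {X s s′} → s ≤ s′ → T X s → T X s′
  open Regular

  private
    variable
      T : Cantor → ℕ → Set

  shift : Regular T → ∀ b → Regular (T ∘ cons b)
  shift r b .pointwise X≗Y = pointwise r λ { zero → refl ; (suc n) → X≗Y n }
  shift r b .mono     = mono r

  glue : Regular T → Uniform (T ∘ cons zero) → Uniform (T ∘ cons (suc zero)) → Uniform T
  glue {T} r (s₀ , p₀) (s₁ , p₁) = s₀ ⊔ s₁ , λ X → both X (X 0) refl
    where
    both : ∀ X b → X 0 ≡ b → T X (s₀ ⊔ s₁)
    both X zero       eq = pointwise r (λ { zero → sym eq ; (suc n) → refl })
      (mono r (m≤m⊔n s₀ s₁) (p₀ (X ∘ suc)))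
    both X (suc zero) eq = pointwise r (λ { zero → sym eq ; (suc n) → refl })
      (mono r (m≤n⊔m s₀ s₁) (p₁ (X ∘ suc)))

  -- Kőnig's lemma: if both halves had a uniform stage, the larger one would serve the whole.
  branch : Regular T → ¬ Uniform T → ∃ λ b → ¬ Uniform (T ∘ cons b)
  branch {T} r ¬u with em {Uniform (T ∘ cons zero)}
  ... | yes u₀ = suc zero , λ u₁ → ¬u (glue r u₀ u₁)
  ... | no ¬u₀ = zero , ¬u₀

  path : Regular T → ¬ Uniform T → Cantor
  path r ¬u zero    = proj₁ (branch r ¬u)
  path r ¬u (suc n) = path (shift r (proj₁ (branch r ¬u))) (proj₂ (branch r ¬u)) n

  -- After `l` bits the path has entered a subtree without a uniform stage, but `s` would be one.
  path-avoids : ∀ l {T} (r : Regular T) (¬u : ¬ Uniform T) s →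
                (∀ X → (∀ q → q < l → path r ¬u q ≡ X q) → T X s) → ⊥
  path-avoids zero    r ¬u s all = ¬u (s , λ X → all X λ q ())
  path-avoids (suc l) r ¬u s all =
    path-avoids l (shift r b) (proj₂ (branch r ¬u)) s λ X agree →
      all (cons b X) λ { zero _ → refl ; (suc q) (s≤s q<l) → agree q q<l }
    where b = proj₁ (branch r ¬u)

  compactness : (∀ {X Y s} → (∀ q → q < s → X q ≡ Y q) → T X s → T Y s) →
                (∀ {X s s′} → s ≤ s′ → T X s → T X s′) →
                (∀ X → ∃ (T X)) → Uniform T
  compactness {T} local mono total with em {Uniform T}
  ... | yes u = u
  -- The stage `s` reached on the path is also its use, so it serves the whole cylinder of the first
  -- `s` bits.
  ... | no ¬u = ⊥-elim (path-avoids s r ¬u s λ X agree → local agree p)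
    where
    r : Regular T
    r = record { pointwise = λ X≗Y → local (λ q _ → X≗Y q) ; mono = mono }
    s = proj₁ (total (path r ¬u))
    p = proj₂ (total (path r ¬u))

-- Binary approximations

bit : ℕ → Fin 2
bit zero    = zero
bit (suc _) = suc zero

toℕ-bit : ∀ v → toℕ (bit v) ≡ ifz v 0 1
toℕ-bit zero    = refl
toℕ-bit (suc _) = refl

bit-toℕ : ∀ b → bit (toℕ b) ≡ b
bit-toℕ zero       = refl
bit-toℕ (suc zero) = refl

prefix : Real → ℕ → ℕ
prefix h = natrec 0 (λ k r → ⟨ h k , r ⟩)

-- The prefix of the constant sequence 1. As pairing is monotone, it bounds all codes of binary
-- strings of the given length.
largest : ℕ → ℕ
largest = natrec 0 (λ _ r → ⟨ 1 , r ⟩)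

-- `prefix` puts the newest bit outermost, so bit `q` lies beneath `s ∸ suc q` others.
approx : ℕ → ℕ → Cantor
approx m s q = bit (π₁ (natrec m (λ _ r → π₂ r) (s ∸ suc q)))

prefix≤largest : ∀ (X : Cantor) s → prefix ⌊ X ⌋ s ≤ largest s
prefix≤largest X zero    = z≤n
prefix≤largest X (suc s) = ⟨,⟩-mono (s≤s⁻¹ (toℕ<n (X s))) (prefix≤largest X s)

prefix-drop : ∀ h j k → natrec (prefix h (j + k)) (λ _ r → π₂ r) j ≡ prefix h k
prefix-drop h zero    k = refl
prefix-drop h (suc j) k = trans
  (cong (λ l → π₂ (natrec (prefix h l) (λ _ r → π₂ r) j)) (sym (+-suc j k)))
  (trans (cong π₂ (prefix-drop h j (suc k))) (π₂-⟨,⟩ (h k) (prefix h k)))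

approx-prefix : ∀ X s q → q < s → approx (prefix ⌊ X ⌋ s) s q ≡ X q
approx-prefix X s q q<s = trans (cong bit eq) (bit-toℕ (X q))
  where
  m = prefix ⌊ X ⌋
  eq : π₁ (natrec (m s) (λ _ r → π₂ r) (s ∸ suc q)) ≡ toℕ (X q)
  eq = trans (cong (λ k → π₁ (natrec (m k) (λ _ r → π₂ r) (s ∸ suc q))) (sym (m∸n+n≡m q<s)))
    (trans (cong π₁ (prefix-drop ⌊ X ⌋ (s ∸ suc q) (suc q))) (π₁-⟨,⟩ (toℕ (X q)) (m q)))

prefixᶜ : {F : Fun K n} (i : K) → Computes F → Computes (λ O ρ → prefix (O i) (F O ρ))
prefixᶜ i f = natrecᶜ zeroᶜ (pairᶜ (oracleᶜ i (wkᶜ varᶜ)) varᶜ) f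

run : Code Bool → Real → ℕ → ℕ → ℕ
run c h m s = step c ((h & λ _ → m) ↾ s) s 0

-- Truncation at `s` hides the oracle from `s` on: the stage is also the use.
run-local : ∀ c {h h′ m s} → (∀ q → q < s → h q ≡ h′ q) → run c h m s ≡ run c h′ m s
run-local c {h} {h′} {m} {s} agree = ≡-by-suc _ _
  (step-mono {s = s} (sub agree) ≤-refl c 0)
  (step-mono {s = s} (sub (λ q → sym ∘ agree q)) ≤-refl c 0)
  where
  sub : ∀ {h h′} → (∀ q → q < s → h q ≡ h′ q) → ∀ i →
        Graph (((h & λ _ → m) ↾ s) i) ⊆₂ Graph (((h′ & λ _ → m) ↾ s) i)
  sub {h} {h′} agree true q v eq with q<s , refl ← ↾-sound (h & λ _ → m) s true q v eq =
    trans (↾-defined (h′ & λ _ → m) true q<s) (cong suc (sym (agree q q<s)))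
  sub agree false q v eq = eq

run-mono : ∀ c {h m s s′} → s ≤ s′ → ∀ y → run c h m s ≡ suc y → run c h m s′ ≡ suc y
run-mono c {h} {m} {s} {s′} s≤s′ = step-mono sub s≤s′ c 0
  where
  sub : ∀ i → Graph (((h & λ _ → m) ↾ s) i) ⊆₂ Graph (((h & λ _ → m) ↾ s′) i)
  sub i q v eq with q<s , refl ← ↾-sound (h & λ _ → m) s i q v eq =
    ↾-defined (h & λ _ → m) i (<-≤-trans q<s s≤s′)

run-sound : ∀ c {h m s y} → run c h m s ≡ suc y → ⟦ c ⟧ (h & λ _ → m) 0 y
run-sound c {h} {m} {s} =
  step-sound (λ i q v eq → proj₂ (↾-sound (h & λ _ → m) s i q v eq)) c s 0 _

undecided : (c d : Code Bool) → Real → ℕ → ℕ → ℕ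
undecided c d h m s = isZero (run c h m s) * isZero (run d h m s)

runᶜ : ∀ c → Computes {⊥} {3} (λ O ρ →
  run c ⌊ approx (proj₂ ρ) (proj₂ (proj₁ ρ)) ⌋ (proj₂ (proj₁ (proj₁ ρ))) (proj₂ (proj₁ ρ)))
runᶜ c = letᶜ (stepᶜ c {ψ} {λ O ρ → proj₂ (proj₁ ρ)} ψᶜ (wkᶜ varᶜ)) zeroᶜ
  where
  ψ : Bool → (⊥ → Real) → Env 3 → ℕ → ℕ
  ψ i O (((_ , m) , s) , p) = ((⌊ approx p s ⌋ & λ _ → m) ↾ s) i
  ψᶜ : ∀ i → Computes {n = 4} (λ O ρ → ψ i O (proj₁ ρ) (proj₂ ρ))
  ψᶜ true  = ifzᶜ (sucᶜ varᶜ ∸ᶜ wkᶜ (wkᶜ varᶜ)) (sucᶜ (ext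
    (ifzᶜ (π₁ᶜ (natrecᶜ (wkᶜ varᶜ) (π₂ᶜ varᶜ) (wkᶜ (wkᶜ varᶜ) ∸ᶜ sucᶜ varᶜ))) zeroᶜ (constᶜ 1))
    (λ O ρ → sym (toℕ-bit _)))) zeroᶜ
  ψᶜ false = ifzᶜ (sucᶜ varᶜ ∸ᶜ wkᶜ (wkᶜ varᶜ)) (sucᶜ (wkᶜ (wkᶜ (wkᶜ varᶜ)))) zeroᶜ

module _ (em : ExcludedMiddle 0ℓ) (c d : Code Bool) where

  open Compactness em

  -- Ranging over `p` up to `largest s` covers all binary strings of length `s`, so success means
  -- that on every set `c` or `d` has halted by stage `s`.
  modulusTest : Fun ⊥ 2
  modulusTest O ((_ , m) , s) = sum< (suc (largest s)) λ p → undecided c d ⌊ approx p s ⌋ m s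

  modulusTestᶜ : Computes modulusTest
  modulusTestᶜ = sum<ᶜ (sucᶜ (natrecᶜ zeroᶜ (pairᶜ (constᶜ 1) varᶜ) varᶜ))
    (isZeroᶜ (runᶜ c) *ᶜ isZeroᶜ (runᶜ d))

  modulus-exists :
    (∀ X m → (∃ λ y → ⟦ c ⟧ (⌊ X ⌋ & λ _ → m) 0 y) ⊎ (∃ λ y → ⟦ d ⟧ (⌊ X ⌋ & λ _ → m) 0 y)) →
    ∀ m → ∃ λ s → modulusTest noOracle ((tt , m) , s) ≡ 0
  modulus-exists total m = map₂
    (λ {s} p → sum<≡0⁻ (suc (largest s)) (λ k → undecided c d ⌊ approx k s ⌋ m s)
      λ k _ → p (approx k s))
    (compactness {T} local mono exists)
    where
    T : Cantor → ℕ → Set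
    T X s = undecided c d ⌊ X ⌋ m s ≡ 0
    local : ∀ {X Y s} → (∀ q → q < s → X q ≡ Y q) → T X s → T Y s
    local {s = s} agree eq = trans (sym (cong₂ (λ a b → isZero a * isZero b)
      (run-local c {s = s} (λ q q<s → cong toℕ (agree q q<s)))
      (run-local d {s = s} (λ q q<s → cong toℕ (agree q q<s))))) eq
    isZero-mono : ∀ {a b} → (∀ y → a ≡ suc y → b ≡ suc y) → isZero a ≡ 0 → isZero b ≡ 0
    isZero-mono {suc a} p eq = cong isZero (p a refl)
    left-true : ∀ {a} b → a ≡ 0 → a * b ≡ 0
    left-true b refl = refl
    right-true : ∀ a {b} → b ≡ 0 → a * b ≡ 0
    right-true a refl = *-zeroʳ a
    mono : ∀ {X s s′} → s ≤ s′ → T X s → T X s′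
    mono {X} {s} {s′} s≤s′ eq with m*n≡0⇒m≡0∨n≡0 (isZero (run c ⌊ X ⌋ m s)) eq
    ... | inj₁ p = left-true _ (isZero-mono (run-mono c s≤s′) p)
    ... | inj₂ p = right-true (isZero (run c ⌊ X ⌋ m s′)) (isZero-mono (run-mono d s≤s′) p)
    exists : ∀ X → ∃ (T X)
    exists X with total X m
    ... | inj₁ (y , p) = let s , eq = step-complete _ c 0 y p in
      s , left-true _ (cong isZero (eq s ≤-refl))
    ... | inj₂ (y , p) = let s , eq = step-complete _ d 0 y p in
      s , right-true (isZero (run c ⌊ X ⌋ m s)) (cong isZero (eq s ≤-refl))

-- The graph of a universal function as a set of natural numbers

point : ∀ 𝒳 → ℕ → Point 𝒳
point nat   m = m
point baire m = λ _ → m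

embed-point : ∀ 𝒳 m → embed 𝒳 (point 𝒳 m) ≡ λ _ → m
embed-point nat   m = refl
embed-point baire m = refl

module Diagonal (em : ExcludedMiddle 0ℓ) (f : Real)
  (index : ∀ c → ∃ λ i → ∀ x y → ⟦ c ⟧ noOracle x y → f ⟨ i , x ⟩ ≡ suc y)
  where

  A : Cantor
  A m = bit (isZero (dist (f (π₁ m)) (π₂ m)))

  isZero-bit : ∀ k → toℕ (bit (isZero k)) ≡ isZero k
  isZero-bit zero    = refl
  isZero-bit (suc _) = refl

  -- Membership in `A` is the bit 1, whereas tests take 0 for truth.
  denies : Real → ℕ → ℕ → ℕ
  denies h x y = isZero (h ⟨ x , y ⟩)

  A-⟨⟩ : ∀ x y → ⌊ A ⌋ ⟨ x , y ⟩ ≡ isZero (dist (f x) y)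
  A-⟨⟩ x y rewrite π₁-⟨,⟩ x y | π₂-⟨,⟩ x y = isZero-bit (dist (f x) y)

  denies-sound : ∀ x y → denies ⌊ A ⌋ x y ≡ 0 → f x ≡ y
  denies-sound x y eq = lemma (trans (sym (cong isZero (A-⟨⟩ x y))) eq)
    where
    lemma : isZero (isZero (dist (f x) y)) ≡ 0 → f x ≡ y
    lemma eq with dist (f x) y in d
    ... | zero = dist≡0⇒≡ (f x) y d

  denies-complete : ∀ x y → f x ≡ y → denies ⌊ A ⌋ x y ≡ 0
  denies-complete x y eq =
    trans (cong isZero (A-⟨⟩ x y)) (cong (isZero ∘ isZero) (≡⇒dist≡0 eq))

  deniesᶜ : {F G : Fun K n} (i : K) → Computes F → Computes G →
            Computes (λ O ρ → denies (O i) (F O ρ) (G O ρ))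
  deniesᶜ i x y = isZeroᶜ (oracleᶜ i (pairᶜ x y))

  -- `f m` is found by searching `A` for the pair with first component `m`. On other oracles this
  -- search may run forever, which is the gap that `Diag` exploits.
  f≡ᵀA : f ≡ᵀ ⌊ A ⌋
  f≡ᵀA = (comp (search test) (pair const0 idCode) , λ m →
            ⟨ 0 , m ⟩ , (0 , m , refl , idCode-correct {⊤} (λ _ → ⌊ A ⌋) m , refl) ,
            search-finds test {ρ = tt , m} (denies-complete m (f m) refl)
              (λ z z<fm eq → <⇒≢ z<fm (sym (denies-sound m z eq))))
       , (comp (program graph) (pair const0 idCode) , λ m →
            ⟨ 0 , m ⟩ , (0 , m , refl , idCode-correct {⊤} (λ _ → f) m , refl) ,
            subst (⟦ program graph ⟧ (λ _ → f) ⟨ 0 , m ⟩)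
              (sym (isZero-bit (dist (f (π₁ m)) (π₂ m))))
              (correct graph (λ _ → f) (tt , m)))
    where
    test : Computes {⊤} {2} (λ O ρ → denies (O tt) (proj₂ (proj₁ ρ)) (proj₂ ρ))
    test = deniesᶜ tt (wkᶜ varᶜ) varᶜ
    graph : Computes {⊤} {1} (λ O ρ → isZero (dist (O tt (π₁ (proj₂ ρ))) (π₂ (proj₂ ρ))))
    graph = isZeroᶜ (distᶜ (oracleᶜ tt (π₁ᶜ varᶜ)) (π₂ᶜ varᶜ))

  -- The inputs of both queries are coded environments, with 0 for the empty one, as `search M` and
  -- `runᶜ c` expect them below.
  query₁ : ℕ → ℕ
  query₁ m = ⟨ π₁ m , ⟨ 0 , m ⟩ ⟩

  query₂ : Real → ℕ → ℕ → ℕ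
  query₂ h m s = ⟨ π₂ m , ⟨ ⟨ ⟨ 0 , m ⟩ , s ⟩ , prefix h s ⟩ ⟩

  -- m = ⟨ i , j ⟩ is read as a truth-table reduction: program i computes the
  -- use s, and program j evaluates the reduction on the first s bits of A.
  Diag : Pred ℕ 0ℓ
  Diag m = ∃ λ s → f (query₁ m) ≡ suc s × f (query₂ ⌊ A ⌋ m s) ≡ 1

  -- Even non-membership has a positive witness in `A`: either the first query has the value 0,
  -- divergence being a value of `f` too, or some use `s` and some answer `v` other than 1 are
  -- confirmed.
  accept reject : Fun Bool 1
  accept O (_ , s) =
    denies (O true) (query₁ m) (suc s) + denies (O true) (query₂ (O true) m s) 1
    where m = O false 0
  reject O (_ , t) =
    denies (O true) (query₁ m) 0 *
    (denies (O true) (query₁ m) (suc s) +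
      (denies (O true) (query₂ (O true) m s) v + isZero (dist v 1)))
    where
    m = O false 0
    s = π₁ t
    v = π₂ t

  private
    query₁ᶜ : {F : Fun K n} → Computes F → Computes (λ O ρ → query₁ (F O ρ))
    query₁ᶜ m = pairᶜ (π₁ᶜ m) (pairᶜ zeroᶜ m)

    query₂ᶜ : {F G : Fun K n} (i : K) → Computes F → Computes G →
              Computes (λ O ρ → query₂ (O i) (F O ρ) (G O ρ))
    query₂ᶜ i m s = pairᶜ (π₂ᶜ m) (pairᶜ (pairᶜ (pairᶜ zeroᶜ m) s) (prefixᶜ i s))

    mᶜ : Computes {Bool} {1} (λ O ρ → O false 0)
    mᶜ = oracleᶜ false zeroᶜ

  acceptᶜ : Computes accept
  acceptᶜ = deniesᶜ true (query₁ᶜ mᶜ) (sucᶜ varᶜ) +ᶜ deniesᶜ true (query₂ᶜ true mᶜ varᶜ) (constᶜ 1)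

  rejectᶜ : Computes reject
  rejectᶜ =
    deniesᶜ true (query₁ᶜ mᶜ) zeroᶜ *ᶜ
    (deniesᶜ true (query₁ᶜ mᶜ) (sucᶜ (π₁ᶜ varᶜ)) +ᶜ
      (deniesᶜ true (query₂ᶜ true mᶜ (π₁ᶜ varᶜ)) (π₂ᶜ varᶜ) +ᶜ
        isZeroᶜ (distᶜ (π₂ᶜ varᶜ) (constᶜ 1))))

  module _ (x : Real) where

    private
      m = x 0
      O = ⌊ A ⌋ & x

    Diag⇒accept : Diag m → ∃ λ s → accept O (tt , s) ≡ 0
    Diag⇒accept (s , p , q) =
      s , cong₂ _+_ (denies-complete (query₁ m) (suc s) p) (denies-complete (query₂ ⌊ A ⌋ m s) 1 q)

    accept⇒Diag : (∃ λ s → accept O (tt , s) ≡ 0) → Diag m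
    accept⇒Diag (s , eq) =
      s , denies-sound (query₁ m) (suc s) (m+n≡0⇒m≡0 (denies ⌊ A ⌋ (query₁ m) (suc s)) eq)
        , denies-sound (query₂ ⌊ A ⌋ m s) 1 (m+n≡0⇒n≡0 (denies ⌊ A ⌋ (query₁ m) (suc s)) eq)

    rejects : ℕ → ℕ → ℕ
    rejects s v =
      denies ⌊ A ⌋ (query₁ m) 0 *
      (denies ⌊ A ⌋ (query₁ m) (suc s) + (denies ⌊ A ⌋ (query₂ ⌊ A ⌋ m s) v + isZero (dist v 1)))

    ¬Diag⇒reject : ¬ Diag m → ∃ λ t → reject O (tt , t) ≡ 0
    ¬Diag⇒reject ¬D = cases (f (query₁ m)) refl
      where
      cases : ∀ k → f (query₁ m) ≡ k → ∃ λ t → reject O (tt , t) ≡ 0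
      cases zero    p =
        0 , cong (_* (denies ⌊ A ⌋ (query₁ m) 1 + (denies ⌊ A ⌋ (query₂ ⌊ A ⌋ m 0) 0 + 0)))
              (denies-complete (query₁ m) 0 p)
      cases (suc s) p =
        ⟨ s , v ⟩ , trans (cong₂ rejects (π₁-⟨,⟩ s v) (π₂-⟨,⟩ s v))
          (trans (cong (denies ⌊ A ⌋ (query₁ m) 0 *_)
            (cong₂ _+_ (denies-complete (query₁ m) (suc s) p)
              (cong₂ _+_ (denies-complete (query₂ ⌊ A ⌋ m s) v refl)
                (isZero-false λ d → ¬D (s , p , dist≡0⇒≡ v 1 d)))))
            (*-zeroʳ (denies ⌊ A ⌋ (query₁ m) 0)))
        where v = f (query₂ ⌊ A ⌋ m s)

    reject⇒¬Diag : (∃ λ t → reject O (tt , t) ≡ 0) → ¬ Diag m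
    reject⇒¬Diag (t , eq) (s , p , q) = refute (π₁ t) (π₂ t) eq
      where
      refute : ∀ s′ v → rejects s′ v ≡ 0 → ⊥
      refute s′ v eq with m*n≡0⇒m≡0∨n≡0 (denies ⌊ A ⌋ (query₁ m) 0) eq
      ... | inj₁ r = 0≢1+n (trans (sym (denies-sound (query₁ m) 0 r)) p)
      ... | inj₂ r = isZero-true (m+n≡0⇒n≡0 (denies ⌊ A ⌋ (query₂ ⌊ A ⌋ m s′) v) r′)
        (≡⇒dist≡0 (trans (sym (denies-sound (query₂ ⌊ A ⌋ m s′) v
          (m+n≡0⇒m≡0 (denies ⌊ A ⌋ (query₂ ⌊ A ⌋ m s′) v) r′)))
          (trans (cong (f ∘ query₂ ⌊ A ⌋ m) s′≡s) q)))
        where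
        r′ = m+n≡0⇒n≡0 (denies ⌊ A ⌋ (query₁ m) (suc s′)) r
        s′≡s : s′ ≡ s
        s′≡s = suc-injective (trans (sym (denies-sound (query₁ m) (suc s′)
          (m+n≡0⇒m≡0 (denies ⌊ A ⌋ (query₁ m) (suc s′)) r))) p)

  module _ (c d : Code Bool)
    (total : ∀ X m → (∃ λ y → ⟦ c ⟧ (⌊ X ⌋ & λ _ → m) 0 y) ⊎ (∃ λ y → ⟦ d ⟧ (⌊ X ⌋ & λ _ → m) 0 y))
    (c-sound : ∀ m → (∃ λ y → ⟦ c ⟧ (⌊ A ⌋ & λ _ → m) 0 y) → Diag m)
    (d-sound : ∀ m → (∃ λ y → ⟦ d ⟧ (⌊ A ⌋ & λ _ → m) 0 y) → ¬ Diag m)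
    where

    private
      M = modulusTestᶜ em c d

      conclude : (∃ λ i → ∀ x y → ⟦ search M ⟧ noOracle x y → f ⟨ i , x ⟩ ≡ suc y) →
                 (∃ λ j → ∀ x y → ⟦ program (runᶜ c) ⟧ noOracle x y → f ⟨ j , x ⟩ ≡ suc y) → ⊥
      conclude (i , fᵢ) (j , fⱼ) = contradict (modulus-exists em c d total m)
        where
        m = ⟨ i , j ⟩
        contradict : (∃ λ s → modulusTest em c d noOracle ((tt , m) , s) ≡ 0) → ⊥
        contradict (s₀ , eq₀) = at (search-halts M {ρ = tt , m} s₀ eq₀)
          where
          at : (∃ λ s → ⟦ search M ⟧ noOracle ⟨ 0 , m ⟩ s) → ⊥
          at (s , halts) = cases (run c ⌊ A ⌋ m s) refl
            where
            p = prefix ⌊ A ⌋ s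
            q₁ : f (query₁ m) ≡ suc s
            q₁ = trans (cong (λ k → f ⟨ k , ⟨ 0 , m ⟩ ⟩) (π₁-⟨,⟩ i j)) (fᵢ ⟨ 0 , m ⟩ s halts)
            agree : ∀ e → run e ⌊ approx p s ⌋ m s ≡ run e ⌊ A ⌋ m s
            agree e = run-local e {s = s} λ q q<s → cong toℕ (approx-prefix A s q q<s)
            q₂ : f (query₂ ⌊ A ⌋ m s) ≡ suc (run c ⌊ A ⌋ m s)
            q₂ = trans (cong (λ k → f ⟨ k , ⟨ ⟨ ⟨ 0 , m ⟩ , s ⟩ , p ⟩ ⟩) (π₂-⟨,⟩ i j))
              (trans (fⱼ _ _ (correct (runᶜ c) noOracle (((tt , m) , s) , p))) (cong suc (agree c)))
            decided : undecided c d ⌊ A ⌋ m s ≡ 0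
            decided = trans
              (sym (cong₂ (λ a b → isZero a * isZero b) (agree c) (agree d)))
              (sum<≡0 (suc (largest s)) (λ p → undecided c d ⌊ approx p s ⌋ m s)
                (search-zero M {ρ = tt , m} halts) p (s≤s (prefix≤largest A s)))
            cases : ∀ k → run c ⌊ A ⌋ m s ≡ k → ⊥
            -- `c` has halted, so the second query is answered by at least 2 and `Diag m` fails.
            cases (suc y) eq = clash (c-sound m (y , run-sound c eq))
              where
              clash : Diag m → ⊥
              clash (s′ , q₁′ , q₂′) with refl ← suc-injective (trans (sym q₁′) q₁) =
                1+n≢0 (suc-injective (trans (sym (trans q₂ (cong suc eq))) q₂′))
            -- `c` has not halted at the modulus, so `d` has; but the second query is answered by 1,
            -- the code of output 0, and `Diag m` holds.
            cases zero eq = d-sound m (_ , run-sound d (nonzero (isZero-true d-stops)))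
                              (s , q₁ , trans q₂ (cong suc eq))
              where
              d-stops : isZero (run d ⌊ A ⌋ m s) ≡ 0
              d-stops = trans (sym (+-identityʳ _))
                (trans (cong (λ k → isZero k * isZero (run d ⌊ A ⌋ m s)) (sym eq)) decided)

    Diag-undecidable : ⊥
    Diag-undecidable = conclude (index (search M)) (index (program (runᶜ c)))

  -- Both spaces at once: in Baire space only the first value of a point counts, and the
  -- diagonalization runs along constant reals.
  A-not-stronglyRelativizes : ∀ 𝒳 → ¬ StronglyRelativizesΔ⁰₁At 𝒳 ⌊ A ⌋
  A-not-stronglyRelativizes 𝒳 relativizes = refute (relativizes D D-Δ)
    where
    D : Pred (Point 𝒳) 0ℓ
    D x = Diag (embed 𝒳 x 0)
    D-Δ : Δ⁰₁In 𝒳 ⌊ A ⌋ D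
    D-Δ = (Projection 𝒳 accept , Projection⇒Σ⁰₁ 𝒳 acceptᶜ (id , id) ,
            (λ {x} → Diag⇒accept (embed 𝒳 x)) , λ {x} → accept⇒Diag (embed 𝒳 x))
        , (Projection 𝒳 reject , Projection⇒Σ⁰₁ 𝒳 rejectᶜ (id , id) ,
            (λ {x} → ¬Diag⇒reject (embed 𝒳 x)) , λ {x} → reject⇒¬Diag (embed 𝒳 x))
    module _ {Q} (D≐Q : D ≐ section 𝒳 Q ⌊ A ⌋) where
      separate : (∃ λ U → Computes U × Q ≐ Projection 𝒳 U) →
                 (∃ λ V → Computes V × ∁ Q ≐ Projection 𝒳 V) → ⊥
      separate (U , Uᶜ , Q≐U) (V , Vᶜ , ∁Q≐V) =
        Diag-undecidable (search Uᶜ) (search Vᶜ) total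
          (λ m halts → subst Diag (cong (λ x → x 0) (embed-point 𝒳 m))
            (proj₂ D≐Q (proj₂ Q≐U (halts⇒ Uᶜ ⌊ A ⌋ m halts))))
          (λ m halts p → proj₂ ∁Q≐V (halts⇒ Vᶜ ⌊ A ⌋ m halts)
            (proj₁ D≐Q (subst Diag (sym (cong (λ x → x 0) (embed-point 𝒳 m))) p)))
        where
        halts⇒ : ∀ {F} (Fᶜ : Computes F) h m → (∃ λ y → ⟦ search Fᶜ ⟧ (h & λ _ → m) 0 y) →
                 Projection 𝒳 F (h , point 𝒳 m)
        halts⇒ {F} Fᶜ h m (y , p) = y , subst (λ x → F (h & x) (tt , y) ≡ 0)
          (sym (embed-point 𝒳 m)) (search-zero Fᶜ {ρ = tt} p)
        ⇒halts : ∀ {F} (Fᶜ : Computes F) h m → Projection 𝒳 F (h , point 𝒳 m) →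
                 ∃ λ y → ⟦ search Fᶜ ⟧ (h & λ _ → m) 0 y
        ⇒halts {F} Fᶜ h m (t , eq) = search-halts Fᶜ {ρ = tt} t
          (subst (λ x → F (h & x) (tt , t) ≡ 0) (embed-point 𝒳 m) eq)
        total : ∀ X m → (∃ λ y → ⟦ search Uᶜ ⟧ (⌊ X ⌋ & λ _ → m) 0 y) ⊎
                        (∃ λ y → ⟦ search Vᶜ ⟧ (⌊ X ⌋ & λ _ → m) 0 y)
        -- Complementarity on all of the product, not only at `A`, makes one search halt on every
        -- set; compactness depends on this.
        total X m with em {Q (⌊ X ⌋ , point 𝒳 m)}
        ... | yes q = inj₁ (⇒halts Uᶜ ⌊ X ⌋ m (proj₁ Q≐U q))
        ... | no ¬q = inj₂ (⇒halts Vᶜ ⌊ X ⌋ m (proj₁ ∁Q≐V ¬q))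
    refute : (∃ λ Q → Δ⁰₁ 𝒳 Q × D ≐ section 𝒳 Q ⌊ A ⌋) → ⊥
    refute (Q , (ΣQ , Σ∁Q) , D≐Q) =
      separate D≐Q (Σ⁰₁⇒Projection 𝒳 ΣQ) (Σ⁰₁⇒Projection 𝒳 Σ∁Q)

theorem20 : ExcludedMiddle 0ℓ →
    (∃₂ λ (f : Real) (A : Cantor) →
    StronglyRelativizesΔ⁰₁At baire f ×
    f ≡ᵀ ⌊ A ⌋ ×
    ¬ StronglyRelativizesΔ⁰₁At baire ⌊ A ⌋ ×
    ¬ StronglyRelativizesΔ⁰₁At nat ⌊ A ⌋) ×
    (∃ λ (f : Real) →
    StronglyRelativizesΔ⁰₁At baire f ×
    ¬ ComputablyDominated f)
theorem20 em =
  (f , A , f-stronglyRelativizes baire , f≡ᵀA ,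
   A-not-stronglyRelativizes baire , A-not-stronglyRelativizes nat) ,
  (f , f-stronglyRelativizes baire , f-not-dominated)
  where
  open Universal em
  open Diagonal em f index
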